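{- Let $k\ge 2$ be an integer and let $\mathcal{A}\subseteq [2k]^{(k)}\cup [2k]^{(k+1)}\cup [2k]^{(k+2)}$ be an intersecting temperate collection of sets. Then $$|\mathcal{A}|\le \frac12\binom{2k}{k}+\binom{2k}{k+1}+\binom{2k-1}{k+2}.$$
   Context: For a positive integer $n$, $[n]=\{1,2,\ldots,n\}$ and $[n]^{(i)}=\{A\subseteq [n]:|A|=i\}$ (empty if $i>n$). A collection $\mathcal{A}$ of subsets of $[n]$ is called temperate if for every $A\in\mathcal{A}$ there are at most $|A|$ proper subsets of $A$ belonging to $\mathcal{A}$. It is called intersecting if $A\cap B\neq\emptyset$ for all $A,B\in\mathcal{A}$. Binomial coefficients $\binom{m}{i}$ with $i>m\ge 0$ are $0$. -}

module Defs where

open import Data.Fin.Subset using (Subset; ∣_∣; _∩_; _⊂_; Nonempty)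
open import Data.Fin.Subset.Properties using (_⊂?_)
open import Data.List.Base using (List; length; filter)
open import Data.List.Membership.Propositional using (_∈_)
open import Data.List.Relation.Unary.Unique.Propositional using (Unique)
open import Data.Nat.Base using (ℕ; _≤_)

-- A collection of subsets of [n] is given by an enumeration without
-- repetition, so that cardinalities are lengths of lists.
record Collection (n : ℕ) : Set where
  field
    members : List (Subset n)
    unique  : Unique members

open Collection public

infix 4 _∈ᶜ_

_∈ᶜ_ : ∀ {n} → Subset n → Collection n → Set
A ∈ᶜ 𝒜 = A ∈ members 𝒜

card : ∀ {n} → Collection n → ℕ
card 𝒜 = length (members 𝒜)

properSubsetsIn : ∀ {n} → Collection n → Subset n → List (Subset n)
properSubsetsIn 𝒜 A = filter (_⊂? A) (members 𝒜)

Temperate : ∀ {n} → Collection n → Set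
Temperate 𝒜 = ∀ A → A ∈ᶜ 𝒜 → length (properSubsetsIn 𝒜 A) ≤ ∣ A ∣

Intersecting : ∀ {n} → Collection n → Set
Intersecting 𝒜 = ∀ A B → A ∈ᶜ 𝒜 → B ∈ᶜ 𝒜 → Nonempty (A ∩ B)

{-# OPTIONS --safe #-}

-- Let a be the number of k-sets of 𝒜, and let p and q be the numbers of (k+1)-sets
-- and (k+2)-sets missing from 𝒜. It suffices that (k - 1) a ≤ (k + 1) (p + q), because
-- 2 a ≤ C(2k, k) by complementation and (k + 1) C(2k-1, k+1) = (k - 1) C(2k-1, k).
-- For a (k+2)-set B let e be the number of k-sets of 𝒜 below B, and put t = C(k+1, 2).
-- Always 2e/t - (e/t)² ≤ 1 and 2e/t ≤ e/(k - 1). If B ∈ 𝒜 then temperateness makes B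
-- contain at least e missing (k+1)-sets, each of which lies in only k - 1 sets B. Hence
-- the sum over B of 2e/t - (e/t)² is at most p + q.
-- The sum of e is C(k, 2) a, and the sum of e² is bounded by the spectral gap of the
-- Johnson scheme: on functions of mean zero on the j-sets of [n] the up operator has
-- squared norm at most j (n - 1 - j), by induction on j from the commutation relation
-- down ∘ up - up ∘ down = n - 2j.
module Submission where

open import Defs
open import Data.Integer.Properties as ℤ using ()
open import Data.Nat.Base as ℕ using (ℕ)
import Data.Nat.Properties as ℕ
open import Data.Nat.Combinatorics using (_C_)
open import Data.Fin.Subset using (∣_∣)
open import Data.Sum.Base using (_⊎_)
open import Relation.Binary.PropositionalEquality using (_≡_)

-- Local, because integer operators are unqualified here and natural ones below.
module _ where
  open import Algebra.Properties.AbelianGroup ℤ.+-0-abelianGroup using (∙-cancelˡ)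
  open import Algebra.Properties.CommutativeSemigroup ℤ.+-commutativeSemigroup using (interchange)
  open import Data.Bool.Properties as Bool using ()
  open import Data.Fin.Subset using (Subset; inside; outside; _⊂_; ∁)
  open import Data.Fin.Subset.Properties
    using (_⊂?_; ⊂-trans; s⊂s; out⊂in; ⊆-refl; ∣∁p∣≡n∸∣p∣; ∣p∣≤n; x∈p∩q⁻; x∈∁p⇒x∉p)
  open import Data.Integer.Base
    using (ℤ; +_; -_; _+_; _*_; _-_; _≤_; 0ℤ; 1ℤ; nonNegative; ≢-nonZero; +≤+)
  open import Data.Integer.Properties using (module ≤-Reasoning)
  open import Data.Integer.Tactic.RingSolver using (solve-∀)
  open import Data.List.Base using (List; []; _∷_; length; filter)
  open import Data.List.Membership.Propositional using (_∈_; _∉_)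
  open import Data.List.Relation.Unary.All as All using ()
  open import Data.List.Relation.Unary.AllPairs using (_∷_)
  open import Data.List.Relation.Unary.Any using (here; there; any?)
  open import Data.List.Relation.Unary.Unique.Propositional using (Unique)
  open import Data.Nat.Base using (zero; suc; _/_; _∸_)
  open import Data.Nat.Combinatorics using (k>n⇒nCk≡0; nCk≡nC[n∸k]; nCk+nC[k+1]≡[n+1]C[k+1])
  open import Data.Nat.DivMod using (m*n/n≡m)
  open import Data.Product.Base using (_,_)
  open import Data.Sum.Base using (inj₁; inj₂)
  open import Data.Vec.Base using ([]; _∷_)
  open import Data.Vec.Properties as Vec using ()
  open import Function.Base using (_∘_)
  open import Relation.Binary.PropositionalEquality
    using (_≢_; _≗_; refl; sym; trans; cong; cong₂; subst; subst₂; module ≡-Reasoning)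
  open import Relation.Nullary using (Dec; yes; no; contradiction)

  private
    variable
      n : ℕ

  -- Integer inequalities with explicit certificates.

  -- The main estimates below end here: the difference of the two sides is written as a sum of
  -- visibly nonnegative terms, and the ring solver checks the identity.
  ≤-by-difference : ∀ {x y d} → 0ℤ ≤ d → y ≡ x + d → x ≤ y
  ≤-by-difference {x} {y} {d} 0≤d y≡x+d = begin
    x      ≡⟨ ℤ.+-identityʳ x ⟨
    x + 0ℤ ≤⟨ ℤ.+-monoʳ-≤ x 0≤d ⟩
    x + d  ≡⟨ y≡x+d ⟨
    y      ∎
    where open ≤-Reasoning

  +-nonneg : ∀ {x y} → 0ℤ ≤ x → 0ℤ ≤ y → 0ℤ ≤ x + y
  +-nonneg = ℤ.+-mono-≤

  *-nonneg : ∀ {x y} → 0ℤ ≤ x → 0ℤ ≤ y → 0ℤ ≤ x * y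
  *-nonneg {+ x} {+ y} _ _ = subst (0ℤ ≤_) (ℤ.pos-* x y) (+≤+ ℕ.z≤n)

  square-nonneg : ∀ x → 0ℤ ≤ x * x
  square-nonneg x with ℤ.≤-total 0ℤ x
  ... | inj₁ 0≤x = *-nonneg 0≤x 0≤x
  ... | inj₂ x≤0 = subst (0ℤ ≤_) (neg-square x) (*-nonneg (ℤ.neg-mono-≤ x≤0) (ℤ.neg-mono-≤ x≤0))
    where
    neg-square : ∀ x → (- x) * (- x) ≡ x * x
    neg-square = solve-∀

  *-monoˡ : ∀ {c x y} → 0ℤ ≤ c → x ≤ y → c * x ≤ c * y
  *-monoˡ {c} 0≤c = ℤ.*-monoˡ-≤-nonNeg c {{nonNegative 0≤c}}

  *-cancelˡ : ∀ {c x y} → 1ℤ ≤ c → c * x ≤ c * y → x ≤ y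
  *-cancelˡ {+ suc c} {x} {y} _ = ℤ.*-cancelˡ-≤-pos x y (+ suc c)
  *-cancelˡ {+ zero} (+≤+ ())

  *-positive : ∀ {x y} → 1ℤ ≤ x → 1ℤ ≤ y → 1ℤ ≤ x * y
  *-positive {+ suc x} {+ suc y} _ _ = +≤+ (ℕ.s≤s ℕ.z≤n)
  *-positive {+ zero} (+≤+ ())
  *-positive {+ suc x} {+ zero} _ (+≤+ ())

  -- The up and down operators on functions on the Boolean lattice

  -- The sum over all subsets of [n] branches on the first element, exactly as `up` and `down` do,
  -- so that identities relating the three follow by one induction on `n`.
  ∑ : (Subset n → ℤ) → ℤ
  ∑ {zero}  f = f []
  ∑ {suc n} f = ∑ (f ∘ (outside ∷_)) + ∑ (f ∘ (inside ∷_))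

  ∑-cong : {f g : Subset n → ℤ} → f ≗ g → ∑ f ≡ ∑ g
  ∑-cong {zero}  f≗g = f≗g []
  ∑-cong {suc n} f≗g = cong₂ _+_ (∑-cong (f≗g ∘ (outside ∷_))) (∑-cong (f≗g ∘ (inside ∷_)))

  ∑-mono : {f g : Subset n → ℤ} → (∀ A → f A ≤ g A) → ∑ f ≤ ∑ g
  ∑-mono {zero}  f≤g = f≤g []
  ∑-mono {suc n} f≤g = ℤ.+-mono-≤ (∑-mono (f≤g ∘ (outside ∷_))) (∑-mono (f≤g ∘ (inside ∷_)))

  ∑-zero : ∑ {n} (λ _ → 0ℤ) ≡ 0ℤ
  ∑-zero {zero}  = refl
  ∑-zero {suc n} = cong₂ _+_ (∑-zero {n}) (∑-zero {n})

  ∑-+ : (f g : Subset n → ℤ) → ∑ (λ A → f A + g A) ≡ ∑ f + ∑ g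
  ∑-+ {zero}  f g = refl
  ∑-+ {suc n} f g =
    trans (cong₂ _+_ (∑-+ (f ∘ (outside ∷_)) (g ∘ (outside ∷_))) (∑-+ (f ∘ (inside ∷_)) (g ∘ (inside ∷_))))
          (interchange (∑ (f ∘ (outside ∷_))) (∑ (g ∘ (outside ∷_))) (∑ (f ∘ (inside ∷_))) (∑ (g ∘ (inside ∷_))))

  ∑-*ˡ : ∀ c (f : Subset n → ℤ) → ∑ (λ A → c * f A) ≡ c * ∑ f
  ∑-*ˡ {zero}  c f = refl
  ∑-*ˡ {suc n} c f =
    trans (cong₂ _+_ (∑-*ˡ {n} c _) (∑-*ˡ {n} c _)) (sym (ℤ.*-distribˡ-+ c _ _))

  ∑-linear : ∀ c d (f g : Subset n → ℤ) → ∑ (λ A → c * f A + d * g A) ≡ c * ∑ f + d * ∑ g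
  ∑-linear {n} c d f g = trans (∑-+ {n} _ _) (cong₂ _+_ (∑-*ˡ c f) (∑-*ˡ d g))

  ∑-nonneg : {f : Subset n → ℤ} → (∀ A → 0ℤ ≤ f A) → 0ℤ ≤ ∑ f
  ∑-nonneg {n} {f} 0≤f = subst (_≤ ∑ f) (∑-zero {n}) (∑-mono 0≤f)

  ⟨_,_⟩ : (f g : Subset n → ℤ) → ℤ
  ⟨ f , g ⟩ = ∑ (λ A → f A * g A)

  ∥_∥² : (Subset n → ℤ) → ℤ
  ∥ f ∥² = ⟨ f , f ⟩

  ∥∥²-nonneg : (f : Subset n → ℤ) → 0ℤ ≤ ∥ f ∥²
  ∥∥²-nonneg f = ∑-nonneg (λ A → square-nonneg (f A))

  ⟨,⟩-cong : {f f′ g g′ : Subset n → ℤ} → f ≗ f′ → g ≗ g′ → ⟨ f , g ⟩ ≡ ⟨ f′ , g′ ⟩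
  ⟨,⟩-cong f≗f′ g≗g′ = ∑-cong (λ A → cong₂ _*_ (f≗f′ A) (g≗g′ A))

  ⟨,⟩-comm : (f g : Subset n → ℤ) → ⟨ f , g ⟩ ≡ ⟨ g , f ⟩
  ⟨,⟩-comm f g = ∑-cong (λ A → ℤ.*-comm (f A) (g A))

  ⟨,⟩-*ʳ : ∀ c (f g : Subset n → ℤ) → ⟨ f , (λ A → c * g A) ⟩ ≡ c * ⟨ f , g ⟩
  ⟨,⟩-*ʳ c f g = trans (∑-cong (λ A → ring-id (f A) c (g A))) (∑-*ˡ c (λ A → f A * g A))
    where
    ring-id : ∀ x c y → x * (c * y) ≡ c * (x * y)
    ring-id = solve-∀

  ∥∥²-linear : ∀ c d (f g : Subset n → ℤ) →
    ∥ (λ A → c * f A + d * g A) ∥² ≡ c * c * ∥ f ∥² + + 2 * (c * d) * ⟨ f , g ⟩ + d * d * ∥ g ∥²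
  ∥∥²-linear {n} c d f g = begin
    ∥ (λ A → c * f A + d * g A) ∥²
      ≡⟨ ∑-cong (λ A → ring-id c d (f A) (g A)) ⟩
    ∑ (λ A → (c * c * (f A * f A) + + 2 * (c * d) * (f A * g A)) + d * d * (g A * g A))
      ≡⟨ ∑-+ {n} _ _ ⟩
    ∑ (λ A → c * c * (f A * f A) + + 2 * (c * d) * (f A * g A)) + ∑ (λ A → d * d * (g A * g A))
      ≡⟨ cong₂ _+_ (∑-linear (c * c) (+ 2 * (c * d)) (λ A → f A * f A) (λ A → f A * g A))
           (∑-*ˡ (d * d) (λ A → g A * g A)) ⟩
    c * c * ∥ f ∥² + + 2 * (c * d) * ⟨ f , g ⟩ + d * d * ∥ g ∥² ∎
    where
    open ≡-Reasoning
    ring-id : ∀ c d x y → (c * x + d * y) * (c * x + d * y)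
            ≡ (c * c * (x * x) + + 2 * (c * d) * (x * y)) + d * d * (y * y)
    ring-id = solve-∀

  -- up f B sums f over the sets B ∖ {x} with x ∈ B, and down f A sums f over the
  -- sets A ∪ {x} with x ∉ A.
  up : (Subset n → ℤ) → (Subset n → ℤ)
  up f []            = 0ℤ
  up f (outside ∷ B) = up (f ∘ (outside ∷_)) B
  up f (inside  ∷ B) = up (f ∘ (inside ∷_)) B + f (outside ∷ B)

  down : (Subset n → ℤ) → (Subset n → ℤ)
  down f []            = 0ℤ
  down f (outside ∷ A) = down (f ∘ (outside ∷_)) A + f (inside ∷ A)
  down f (inside  ∷ A) = down (f ∘ (inside ∷_)) A

  up-cong : {f g : Subset n → ℤ} → f ≗ g → up f ≗ up g
  up-cong f≗g []            = refl
  up-cong f≗g (outside ∷ B) = up-cong (f≗g ∘ (outside ∷_)) B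
  up-cong f≗g (inside  ∷ B) = cong₂ _+_ (up-cong (f≗g ∘ (inside ∷_)) B) (f≗g (outside ∷ B))

  down-cong : {f g : Subset n → ℤ} → f ≗ g → down f ≗ down g
  down-cong f≗g []            = refl
  down-cong f≗g (outside ∷ A) = cong₂ _+_ (down-cong (f≗g ∘ (outside ∷_)) A) (f≗g (inside ∷ A))
  down-cong f≗g (inside  ∷ A) = down-cong (f≗g ∘ (inside ∷_)) A

  up-+ : (f g : Subset n → ℤ) (B : Subset n) → up (λ A → f A + g A) B ≡ up f B + up g B
  up-+ f g []            = refl
  up-+ f g (outside ∷ B) = up-+ _ _ B
  up-+ f g (inside  ∷ B) =
    trans (cong (_+ (f (outside ∷ B) + g (outside ∷ B))) (up-+ (f ∘ (inside ∷_)) (g ∘ (inside ∷_)) B))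
          (interchange (up (f ∘ (inside ∷_)) B) (up (g ∘ (inside ∷_)) B) (f (outside ∷ B)) (g (outside ∷ B)))

  down-+ : (f g : Subset n → ℤ) (A : Subset n) → down (λ B → f B + g B) A ≡ down f A + down g A
  down-+ f g []            = refl
  down-+ f g (outside ∷ A) =
    trans (cong (_+ (f (inside ∷ A) + g (inside ∷ A))) (down-+ (f ∘ (outside ∷_)) (g ∘ (outside ∷_)) A))
          (interchange (down (f ∘ (outside ∷_)) A) (down (g ∘ (outside ∷_)) A) (f (inside ∷ A)) (g (inside ∷ A)))
  down-+ f g (inside  ∷ A) = down-+ _ _ A

  up-* : ∀ c (f : Subset n → ℤ) B → up (λ A → c * f A) B ≡ c * up f B
  up-* c f []            = sym (ℤ.*-zeroʳ c)
  up-* c f (outside ∷ B) = up-* c _ B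
  up-* c f (inside  ∷ B) =
    trans (cong (_+ c * f (outside ∷ B)) (up-* c (f ∘ (inside ∷_)) B))
          (sym (ℤ.*-distribˡ-+ c (up (f ∘ (inside ∷_)) B) (f (outside ∷ B))))

  up-linear : ∀ c d (f g : Subset n → ℤ) (B : Subset n) →
    up (λ A → c * f A + d * g A) B ≡ c * up f B + d * up g B
  up-linear c d f g B =
    trans (up-+ (λ A → c * f A) (λ A → d * g A) B) (cong₂ _+_ (up-* c f B) (up-* d g B))

  down-* : ∀ c (f : Subset n → ℤ) A → down (λ B → c * f B) A ≡ c * down f A
  down-* c f []            = sym (ℤ.*-zeroʳ c)
  down-* c f (outside ∷ A) =
    trans (cong (_+ c * f (inside ∷ A)) (down-* c (f ∘ (outside ∷_)) A))
          (sym (ℤ.*-distribˡ-+ c (down (f ∘ (outside ∷_)) A) (f (inside ∷ A))))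
  down-* c f (inside  ∷ A) = down-* c _ A

  up-nonneg : {f : Subset n → ℤ} → (∀ A → 0ℤ ≤ f A) → ∀ B → 0ℤ ≤ up f B
  up-nonneg 0≤f []            = ℤ.≤-refl
  up-nonneg 0≤f (outside ∷ B) = up-nonneg (0≤f ∘ (outside ∷_)) B
  up-nonneg 0≤f (inside  ∷ B) = +-nonneg (up-nonneg (0≤f ∘ (inside ∷_)) B) (0≤f (outside ∷ B))

  -- Both sides sum `f A * g B` over the pairs in which `B` arises from `A` by adding one element.
  -- The pairs that differ in the first element give the term `⟨ f₀ , g₁ ⟩`.
  adjoint : (f g : Subset n → ℤ) → ⟨ up f , g ⟩ ≡ ⟨ f , down g ⟩
  adjoint {zero}  f g = sym (ℤ.*-zeroʳ (f []))
  adjoint {suc n} f g = begin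
    ⟨ up f₀ , g₀ ⟩ + ∑ (λ A → (up f₁ A + f₀ A) * g₁ A)
      ≡⟨ cong (λ s → ⟨ up f₀ , g₀ ⟩ + s)
           (trans (∑-cong (λ A → ℤ.*-distribʳ-+ (g₁ A) (up f₁ A) (f₀ A))) (∑-+ {n} _ _)) ⟩
    ⟨ up f₀ , g₀ ⟩ + (⟨ up f₁ , g₁ ⟩ + ⟨ f₀ , g₁ ⟩)
      ≡⟨ cong₂ (λ s t → s + (t + ⟨ f₀ , g₁ ⟩)) (adjoint f₀ g₀) (adjoint f₁ g₁) ⟩
    ⟨ f₀ , down g₀ ⟩ + (⟨ f₁ , down g₁ ⟩ + ⟨ f₀ , g₁ ⟩)
      ≡⟨ rearrange ⟨ f₀ , down g₀ ⟩ ⟨ f₁ , down g₁ ⟩ ⟨ f₀ , g₁ ⟩ ⟩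
    (⟨ f₀ , down g₀ ⟩ + ⟨ f₀ , g₁ ⟩) + ⟨ f₁ , down g₁ ⟩
      ≡⟨ cong (_+ ⟨ f₁ , down g₁ ⟩)
           (trans (∑-cong (λ A → ℤ.*-distribˡ-+ (f₀ A) (down g₀ A) (g₁ A))) (∑-+ {n} _ _)) ⟨
    ∑ (λ A → f₀ A * (down g₀ A + g₁ A)) + ⟨ f₁ , down g₁ ⟩ ∎
    where
    open ≡-Reasoning
    f₀ = f ∘ (outside ∷_)
    f₁ = f ∘ (inside ∷_)
    g₀ = g ∘ (outside ∷_)
    g₁ = g ∘ (inside ∷_)
    rearrange : ∀ a b c → a + (b + c) ≡ (a + c) + b
    rearrange = solve-∀

  -- Exchanging an element of `A` for an outside one can be done by adding first or by removing
  -- first, so these terms agree. What remains is `f A` itself, reached by adding and removing in n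
  -- - |A| ways and by removing and adding in |A| ways.
  down-up : (f : Subset n → ℤ) (A : Subset n) →
    down (up f) A ≡ up (down f) A + (+ n - + 2 * + ∣ A ∣) * f A
  down-up {zero}  f []            = refl
  down-up {suc n} f (outside ∷ A) = begin
    down (up f₀) A + (up f₁ A + f₀ A)
      ≡⟨ cong (_+ (up f₁ A + f₀ A)) (down-up f₀ A) ⟩
    (up (down f₀) A + (+ n - + 2 * + ∣ A ∣) * f₀ A) + (up f₁ A + f₀ A)
      ≡⟨ ring-id (up (down f₀) A) (up f₁ A) (+ n) (+ ∣ A ∣) (f₀ A) ⟩
    (up (down f₀) A + up f₁ A) + ((1ℤ + + n) - + 2 * + ∣ A ∣) * f₀ A
      ≡⟨ cong (_+ ((1ℤ + + n) - + 2 * + ∣ A ∣) * f₀ A) (up-+ (down f₀) f₁ A) ⟨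
    up (λ B → down f₀ B + f₁ B) A + ((1ℤ + + n) - + 2 * + ∣ A ∣) * f₀ A ∎
    where
    open ≡-Reasoning
    f₀ = f ∘ (outside ∷_)
    f₁ = f ∘ (inside ∷_)
    ring-id : ∀ u v n a x → (u + (n - + 2 * a) * x) + (v + x) ≡ (u + v) + ((1ℤ + n) - + 2 * a) * x
    ring-id = solve-∀
  down-up {suc n} f (inside ∷ A) = begin
    down (λ B → up f₁ B + f₀ B) A
      ≡⟨ down-+ (up f₁) f₀ A ⟩
    down (up f₁) A + down f₀ A
      ≡⟨ cong (_+ down f₀ A) (down-up f₁ A) ⟩
    (up (down f₁) A + (+ n - + 2 * + ∣ A ∣) * f₁ A) + down f₀ A
      ≡⟨ ring-id (up (down f₁) A) (down f₀ A) (+ n) (+ ∣ A ∣) (f₁ A) ⟩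
    (up (down f₁) A + (down f₀ A + f₁ A)) + ((1ℤ + + n) - + 2 * (1ℤ + + ∣ A ∣)) * f₁ A ∎
    where
    open ≡-Reasoning
    f₀ = f ∘ (outside ∷_)
    f₁ = f ∘ (inside ∷_)
    ring-id : ∀ u v n a x → (u + (n - + 2 * a) * x) + v ≡ (u + (v + x)) + ((1ℤ + n) - + 2 * (1ℤ + a)) * x
    ring-id = solve-∀

  -- Each `A` can be enlarged by one element in n - |A| ways.
  ∑-up : (f : Subset n → ℤ) → ∑ (up f) ≡ ∑ (λ A → (+ n - + ∣ A ∣) * f A)
  ∑-up {zero}  f = refl
  ∑-up {suc n} f = begin
    ∑ (up f₀) + ∑ (λ A → up f₁ A + f₀ A)
      ≡⟨ cong (λ s → ∑ (up f₀) + s) (∑-+ (up f₁) f₀) ⟩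
    ∑ (up f₀) + (∑ (up f₁) + ∑ f₀)
      ≡⟨ cong₂ (λ s t → s + (t + ∑ f₀)) (∑-up f₀) (∑-up f₁) ⟩
    ∑ (λ A → (+ n - + ∣ A ∣) * f₀ A) + (∑ (λ A → (+ n - + ∣ A ∣) * f₁ A) + ∑ f₀)
      ≡⟨ rearrange (∑ (λ A → (+ n - + ∣ A ∣) * f₀ A)) (∑ (λ A → (+ n - + ∣ A ∣) * f₁ A)) (∑ f₀) ⟩
    (∑ (λ A → (+ n - + ∣ A ∣) * f₀ A) + ∑ f₀) + ∑ (λ A → (+ n - + ∣ A ∣) * f₁ A)
      ≡⟨ cong₂ _+_ (trans (sym (∑-+ {n} _ _)) (∑-cong (λ A → eq₀ (+ n) (+ ∣ A ∣) (f₀ A))))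
                   (∑-cong (λ A → eq₁ (+ n) (+ ∣ A ∣) (f₁ A))) ⟩
    ∑ (λ A → ((1ℤ + + n) - + ∣ A ∣) * f₀ A) + ∑ (λ A → ((1ℤ + + n) - (1ℤ + + ∣ A ∣)) * f₁ A) ∎
    where
    open ≡-Reasoning
    f₀ = f ∘ (outside ∷_)
    f₁ = f ∘ (inside ∷_)
    rearrange : ∀ a b c → a + (b + c) ≡ (a + c) + b
    rearrange = solve-∀
    eq₀ : ∀ n a x → (n - a) * x + x ≡ ((1ℤ + n) - a) * x
    eq₀ = solve-∀
    eq₁ : ∀ n a x → (n - a) * x ≡ ((1ℤ + n) - (1ℤ + a)) * x
    eq₁ = solve-∀

  ∑-down : (f : Subset n → ℤ) → ∑ (down f) ≡ ∑ (λ A → + ∣ A ∣ * f A)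
  ∑-down {zero}  f = refl
  ∑-down {suc n} f = begin
    ∑ (λ A → down f₀ A + f₁ A) + ∑ (down f₁)
      ≡⟨ cong (_+ ∑ (down f₁)) (∑-+ (down f₀) f₁) ⟩
    (∑ (down f₀) + ∑ f₁) + ∑ (down f₁)
      ≡⟨ cong₂ (λ s t → (s + ∑ f₁) + t) (∑-down f₀) (∑-down f₁) ⟩
    (∑ (λ A → + ∣ A ∣ * f₀ A) + ∑ f₁) + ∑ (λ A → + ∣ A ∣ * f₁ A)
      ≡⟨ ℤ.+-assoc (∑ (λ A → + ∣ A ∣ * f₀ A)) _ _ ⟩
    ∑ (λ A → + ∣ A ∣ * f₀ A) + (∑ f₁ + ∑ (λ A → + ∣ A ∣ * f₁ A))
      ≡⟨ cong (λ s → ∑ (λ A → + ∣ A ∣ * f₀ A) + s)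
          (trans (sym (∑-+ {n} _ _)) (∑-cong (λ A → sym (ℤ.suc-* (+ ∣ A ∣) (f₁ A))))) ⟩
    ∑ (λ A → + ∣ A ∣ * f₀ A) + ∑ (λ A → (1ℤ + + ∣ A ∣) * f₁ A) ∎
    where
    open ≡-Reasoning
    f₀ = f ∘ (outside ∷_)
    f₁ = f ∘ (inside ∷_)

  -- A Poincaré inequality on the layers

  -- Support on the sets of size J, stated so that passing to J - 1 needs no case J = 0.
  Level : ℤ → (Subset n → ℤ) → Set
  Level J f = ∀ A → + ∣ A ∣ * f A ≡ J * f A

  -- Every set that `up f B` sums over has one element fewer than `B`, so the size can be moved
  -- inside the operator. This and `down-rank` make the operators shift levels by one.
  up-rank : (f : Subset n → ℤ) (B : Subset n) →
    + ∣ B ∣ * up f B ≡ up (λ A → (1ℤ + + ∣ A ∣) * f A) B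
  up-rank f []            = refl
  up-rank f (outside ∷ B) = up-rank (f ∘ (outside ∷_)) B
  up-rank f (inside  ∷ B) = begin
    (1ℤ + + ∣ B ∣) * (up f₁ B + f₀ B)
      ≡⟨ ring-id (+ ∣ B ∣) (up f₁ B) (f₀ B) ⟩
    (+ ∣ B ∣ * up f₁ B + up f₁ B) + (1ℤ + + ∣ B ∣) * f₀ B
      ≡⟨ cong (λ s → (s + up f₁ B) + (1ℤ + + ∣ B ∣) * f₀ B) (up-rank f₁ B) ⟩
    (up (λ A → (1ℤ + + ∣ A ∣) * f₁ A) B + up f₁ B) + (1ℤ + + ∣ B ∣) * f₀ B
      ≡⟨ cong (_+ (1ℤ + + ∣ B ∣) * f₀ B) (up-+ (λ A → (1ℤ + + ∣ A ∣) * f₁ A) f₁ B) ⟨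
    up (λ A → (1ℤ + + ∣ A ∣) * f₁ A + f₁ A) B + (1ℤ + + ∣ B ∣) * f₀ B
      ≡⟨ cong (_+ (1ℤ + + ∣ B ∣) * f₀ B) (up-cong (λ A → succ (1ℤ + + ∣ A ∣) (f₁ A)) B) ⟩
    up (λ A → (1ℤ + (1ℤ + + ∣ A ∣)) * f₁ A) B + (1ℤ + + ∣ B ∣) * f₀ B ∎
    where
    open ≡-Reasoning
    f₀ = f ∘ (outside ∷_)
    f₁ = f ∘ (inside ∷_)
    ring-id : ∀ b u x → (1ℤ + b) * (u + x) ≡ (b * u + u) + (1ℤ + b) * x
    ring-id = solve-∀
    succ : ∀ a x → a * x + x ≡ (1ℤ + a) * x
    succ = solve-∀

  down-rank : (f : Subset n → ℤ) (A : Subset n) →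
    (1ℤ + + ∣ A ∣) * down f A ≡ down (λ B → + ∣ B ∣ * f B) A
  down-rank f []            = refl
  down-rank f (outside ∷ A) =
    trans (ℤ.*-distribˡ-+ (1ℤ + + ∣ A ∣) (down (f ∘ (outside ∷_)) A) (f (inside ∷ A)))
          (cong (_+ (1ℤ + + ∣ A ∣) * f (inside ∷ A)) (down-rank (f ∘ (outside ∷_)) A))
  down-rank f (inside ∷ A) = begin
    (1ℤ + (1ℤ + + ∣ A ∣)) * down f₁ A
      ≡⟨ succ (1ℤ + + ∣ A ∣) (down f₁ A) ⟨
    (1ℤ + + ∣ A ∣) * down f₁ A + down f₁ A
      ≡⟨ cong (_+ down f₁ A) (down-rank f₁ A) ⟩
    down (λ B → + ∣ B ∣ * f₁ B) A + down f₁ A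
      ≡⟨ down-+ (λ B → + ∣ B ∣ * f₁ B) f₁ A ⟨
    down (λ B → + ∣ B ∣ * f₁ B + f₁ B) A
      ≡⟨ down-cong (λ B → succ (+ ∣ B ∣) (f₁ B)) A ⟩
    down (λ B → (1ℤ + + ∣ B ∣) * f₁ B) A ∎
    where
    open ≡-Reasoning
    f₁ = f ∘ (inside ∷_)
    succ : ∀ a x → a * x + x ≡ (1ℤ + a) * x
    succ = solve-∀

  up-level : ∀ J {f : Subset n → ℤ} → Level J f → Level (1ℤ + J) (up f)
  up-level J {f} lf B = begin
    + ∣ B ∣ * up f B                   ≡⟨ up-rank f B ⟩
    up (λ A → (1ℤ + + ∣ A ∣) * f A) B  ≡⟨ up-cong shift B ⟩
    up (λ A → (1ℤ + J) * f A) B        ≡⟨ up-* (1ℤ + J) f B ⟩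
    (1ℤ + J) * up f B                  ∎
    where
    open ≡-Reasoning
    shift : ∀ A → (1ℤ + + ∣ A ∣) * f A ≡ (1ℤ + J) * f A
    shift A = trans (ℤ.suc-* (+ ∣ A ∣) (f A))
                    (trans (cong (λ s → f A + s) (lf A)) (sym (ℤ.suc-* J (f A))))

  -- Starting from `1ℤ + J` avoids subtraction: `down-rank` yields the factor 1 + |A|, and one copy
  -- of `down f A` is then cancelled from both sides.
  down-level : ∀ J {f : Subset n → ℤ} → Level (1ℤ + J) f → Level J (down f)
  down-level J {f} lf A = ∙-cancelˡ (down f A) _ _ (begin
    down f A + + ∣ A ∣ * down f A       ≡⟨ ℤ.suc-* (+ ∣ A ∣) (down f A) ⟨
    (1ℤ + + ∣ A ∣) * down f A           ≡⟨ down-rank f A ⟩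
    down (λ B → + ∣ B ∣ * f B) A        ≡⟨ down-cong lf A ⟩
    down (λ B → (1ℤ + J) * f B) A       ≡⟨ down-* (1ℤ + J) f A ⟩
    (1ℤ + J) * down f A                 ≡⟨ ℤ.suc-* J (down f A) ⟩
    down f A + J * down f A             ∎)
    where open ≡-Reasoning

  ∑-down-level : ∀ J {f : Subset n → ℤ} → Level J f → ∑ (down f) ≡ J * ∑ f
  ∑-down-level J {f} lf = trans (∑-down f) (trans (∑-cong lf) (∑-*ˡ J f))

  ∑-up-level : ∀ J {f : Subset n → ℤ} → Level J f → ∑ (up f) ≡ (+ n - J) * ∑ f
  ∑-up-level {n} J {f} lf =
    trans (∑-up f) (trans (∑-cong (λ A → codegree (+ ∣ A ∣) (f A) (lf A))) (∑-*ˡ (+ n - J) f))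
    where
    expand : ∀ n a x → (n - a) * x ≡ n * x - a * x
    expand = solve-∀
    codegree : ∀ a x → a * x ≡ J * x → (+ n - a) * x ≡ (+ n - J) * x
    codegree a x ax≡Jx =
      trans (expand (+ n) a x) (trans (cong (λ y → + n * x - y) ax≡Jx) (sym (expand (+ n) J x)))

  -- Adjointness gives `⟨ f , down (up f) ⟩`, the commutation relation exchanges the operators, and
  -- on a single level its coefficient is the constant n - 2J.
  ∥up∥² : ∀ J {f : Subset n → ℤ} → Level J f → ∥ up f ∥² ≡ ∥ down f ∥² + (+ n - + 2 * J) * ∥ f ∥²
  ∥up∥² {n} J {f} lf = begin
    ⟨ up f , up f ⟩
      ≡⟨ adjoint f (up f) ⟩
    ⟨ f , down (up f) ⟩
      ≡⟨ ∑-cong (λ A → trans (cong (f A *_) (down-up f A))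
           (trans (expand (f A) (up (down f) A) (+ n) (+ ∣ A ∣))
             (cong (λ s → f A * up (down f) A + (+ n * (f A * f A) - + 2 * (f A * s))) (lf A)))) ⟩
    ∑ (λ A → f A * up (down f) A + (+ n * (f A * f A) - + 2 * (f A * (J * f A))))
      ≡⟨ ∑-cong (λ A → cong (λ s → f A * up (down f) A + s) (collect (f A) (+ n) J)) ⟩
    ∑ (λ A → f A * up (down f) A + (+ n - + 2 * J) * (f A * f A))
      ≡⟨ ∑-+ (λ A → f A * up (down f) A) (λ A → (+ n - + 2 * J) * (f A * f A)) ⟩
    ⟨ f , up (down f) ⟩ + ∑ (λ A → (+ n - + 2 * J) * (f A * f A))
      ≡⟨ cong₂ _+_ (trans (⟨,⟩-comm f (up (down f))) (adjoint (down f) f))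
                   (∑-*ˡ (+ n - + 2 * J) (λ A → f A * f A)) ⟩
    ∥ down f ∥² + (+ n - + 2 * J) * ∥ f ∥² ∎
    where
    open ≡-Reasoning
    expand : ∀ x u n a → x * (u + (n - + 2 * a) * x) ≡ x * u + (n * (x * x) - + 2 * (x * (a * x)))
    expand = solve-∀
    collect : ∀ x n J → n * (x * x) - + 2 * (x * (J * x)) ≡ (n - + 2 * J) * (x * x)
    collect = solve-∀

  -- Only the empty set has size 0, and the value there is the whole sum.
  level-0 : {f : Subset n → ℤ} → Level 0ℤ f → ∑ f ≡ 0ℤ → ∀ A → f A ≡ 0ℤ
  level-0 {zero}      lf ∑f≡0 []            = ∑f≡0
  level-0 {suc n} {f} lf ∑f≡0 (inside  ∷ A) =
    ℤ.*-cancelˡ-≡ (+ suc ∣ A ∣) _ 0ℤ (trans (lf (inside ∷ A)) (sym (ℤ.*-zeroʳ (+ suc ∣ A ∣))))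
  level-0 {suc n} {f} lf ∑f≡0 (outside ∷ A) = level-0 (lf ∘ (outside ∷_)) ∑f₀≡0 A
    where
    ∑f₁≡0 : ∑ (f ∘ (inside ∷_)) ≡ 0ℤ
    ∑f₁≡0 = trans (∑-cong (level-0 lf ∑f≡0 ∘ (inside ∷_))) (∑-zero {n})
    ∑f₀≡0 : ∑ (f ∘ (outside ∷_)) ≡ 0ℤ
    ∑f₀≡0 = trans (sym (trans (cong (λ s → ∑ (f ∘ (outside ∷_)) + s) ∑f₁≡0) (ℤ.+-identityʳ _))) ∑f≡0

  -- Induction on the level, beginning at level 1. With J the lower level, the norm of `down` into
  -- it is controlled by the bound for `up` out of it, and the commutation term completes the
  -- constant: J (n - 1 - J) + (n - 2 (J + 1)) = (J + 1) (n - 2 - J).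
  poincaré : ∀ j {f : Subset n → ℤ} → suc j ℕ.< n → Level (+ suc j) f → ∑ f ≡ 0ℤ →
    ∥ up f ∥² ≤ + suc j * (+ n - 1ℤ - + suc j) * ∥ f ∥²
  poincaré {n} zero {f} j<n lf ∑f≡0 = ℤ.≤-reflexive (begin
    ∥ up f ∥²                              ≡⟨ ∥up∥² (+ 1) lf ⟩
    ∥ down f ∥² + (+ n - + 2 * + 1) * ∥ f ∥²
      ≡⟨ cong (_+ (+ n - + 2 * + 1) * ∥ f ∥²) ∥down∥²≡0 ⟩
    0ℤ + (+ n - + 2 * + 1) * ∥ f ∥²         ≡⟨ ring-id (+ n) ∥ f ∥² ⟩
    + 1 * (+ n - 1ℤ - + 1) * ∥ f ∥²         ∎)
    where
    open ≡-Reasoning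
    -- At level 1 the function `down f` lives on the empty set and has sum zero, so only the
    -- commutation term survives.
    down≡0 : ∀ A → down f A ≡ 0ℤ
    down≡0 = level-0 (down-level 0ℤ lf) (trans (∑-down-level (+ 1) lf) (trans (ℤ.*-identityˡ (∑ f)) ∑f≡0))
    ∥down∥²≡0 : ∥ down f ∥² ≡ 0ℤ
    ∥down∥²≡0 = trans (∑-cong (λ A → cong₂ _*_ (down≡0 A) (down≡0 A))) (∑-zero {n})
    ring-id : ∀ n x → 0ℤ + (n - + 2 * + 1) * x ≡ + 1 * (n - 1ℤ - + 1) * x
    ring-id = solve-∀
  poincaré {n} (suc j) {f} j<n lf ∑f≡0 = begin
    ∥ up f ∥²                                ≡⟨ ∥up∥² (1ℤ + J) lf ⟩
    ∥ g ∥² + (+ n - + 2 * (1ℤ + J)) * ∥ f ∥²   ≤⟨ ℤ.+-monoˡ-≤ _ ∥g∥²≤α∥f∥² ⟩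
    α * ∥ f ∥² + (+ n - + 2 * (1ℤ + J)) * ∥ f ∥² ≡⟨ ring-id J (+ n) ∥ f ∥² ⟩
    (1ℤ + J) * (+ n - 1ℤ - (1ℤ + J)) * ∥ f ∥² ∎
    where
    open ≤-Reasoning
    J = + suc j
    g = down f
    α = J * (+ n - 1ℤ - J)
    ring-id : ∀ J n x → J * (n - 1ℤ - J) * x + (n - + 2 * (1ℤ + J)) * x
                      ≡ (1ℤ + J) * (n - 1ℤ - (1ℤ + J)) * x
    ring-id = solve-∀
    gap : ∀ J n → n - 1ℤ - J ≡ 1ℤ + (n - (1ℤ + (1ℤ + J)))
    gap = solve-∀
    -- Strictness of the bound on the level makes `α` positive, so that it can be cancelled at the
    -- end.
    1≤α : 1ℤ ≤ α
    1≤α = *-positive {J} (+≤+ (ℕ.s≤s ℕ.z≤n))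
      (≤-by-difference (ℤ.i≤j⇒0≤j-i (+≤+ j<n)) (gap J (+ n)))
    ∑g≡0 : ∑ g ≡ 0ℤ
    ∑g≡0 = trans (∑-down-level (1ℤ + J) lf) (trans (cong ((1ℤ + J) *_) ∑f≡0) (ℤ.*-zeroʳ (1ℤ + J)))
    ih : ∥ up g ∥² ≤ α * ∥ g ∥²
    ih = poincaré j (ℕ.<-trans (ℕ.n<1+n (suc j)) j<n) (down-level J lf) ∑g≡0
    -- The bound for `up` passes to its adjoint. In `0 ≤ ∥ up g - α f ∥²` the cross term is `∥ g ∥²`
    -- by adjointness, and inserting `∥ up g ∥² ≤ α * ∥ g ∥²` leaves
    -- `α * ∥ g ∥² ≤ α * (α * ∥ f ∥²)`.
    ∥ug-αf∥² : ∥ (λ A → 1ℤ * up g A + (- α) * f A) ∥²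
             ≡ ∥ up g ∥² - + 2 * α * ∥ g ∥² + α * α * ∥ f ∥²
    ∥ug-αf∥² = trans (∥∥²-linear 1ℤ (- α) (up g) f)
      (trans (cong (λ s → 1ℤ * 1ℤ * ∥ up g ∥² + + 2 * (1ℤ * (- α)) * s + (- α) * (- α) * ∥ f ∥²)
             (adjoint g f))
             (tidy α ∥ up g ∥² ∥ g ∥² ∥ f ∥²))
      where
      tidy : ∀ α x y z → 1ℤ * 1ℤ * x + + 2 * (1ℤ * (- α)) * y + (- α) * (- α) * z
                       ≡ x - + 2 * α * y + α * α * z
      tidy = solve-∀
    ∥g∥²≤α∥f∥² : ∥ g ∥² ≤ α * ∥ f ∥²
    ∥g∥²≤α∥f∥² = *-cancelˡ 1≤α (≤-by-difference
      (+-nonneg (subst (0ℤ ≤_) ∥ug-αf∥² (∥∥²-nonneg (λ A → 1ℤ * up g A + (- α) * f A)))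
                (ℤ.i≤j⇒0≤j-i ih))
      (combine α ∥ up g ∥² ∥ g ∥² ∥ f ∥²))
      where
      combine : ∀ α x y z → α * (α * z) ≡ α * y + ((x - + 2 * α * y + α * α * z) + (α * y - x))
      combine = solve-∀

  -- Functions on one layer and the indicator functions of layers.

  off-level : ∀ j {f : Subset n → ℤ} → Level (+ j) f → ∀ A → ∣ A ∣ ≢ j → f A ≡ 0ℤ
  off-level j {f} lf A ∣A∣≢j with f A ℤ.≟ 0ℤ
  ... | yes fA≡0 = fA≡0
  ... | no  fA≢0 =
    contradiction (ℤ.+-injective (ℤ.*-cancelʳ-≡ (+ ∣ A ∣) (+ j) (f A) {{≢-nonZero fA≢0}} (lf A))) ∣A∣≢j

  linear-level : ∀ J c d {f g : Subset n → ℤ} → Level J f → Level J g → Level J (λ A → c * f A + d * g A)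
  linear-level J c d {f} {g} lf lg A = begin
    + ∣ A ∣ * (c * f A + d * g A)               ≡⟨ distrib (+ ∣ A ∣) c d (f A) (g A) ⟩
    c * (+ ∣ A ∣ * f A) + d * (+ ∣ A ∣ * g A)   ≡⟨ cong₂ (λ x y → c * x + d * y) (lf A) (lg A) ⟩
    c * (J * f A) + d * (J * g A)               ≡⟨ distrib J c d (f A) (g A) ⟨
    J * (c * f A + d * g A)                     ∎
    where
    open ≡-Reasoning
    distrib : ∀ a c d x y → a * (c * x + d * y) ≡ c * (a * x) + d * (a * y)
    distrib = solve-∀

  -- The indicator of the j-sets, by recursion on the set instead of a comparison of sizes, so that
  -- it reduces together with `∑`, `up` and `down`.
  layer : ℕ → Subset n → ℤ
  layer j       (outside ∷ A) = layer j A
  layer zero    []            = 1ℤ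
  layer (suc j) []            = 0ℤ
  layer zero    (inside  ∷ A) = 0ℤ
  layer (suc j) (inside  ∷ A) = layer j A

  layer-on : (A : Subset n) → layer ∣ A ∣ A ≡ 1ℤ
  layer-on []            = refl
  layer-on (outside ∷ A) = layer-on A
  layer-on (inside  ∷ A) = layer-on A

  layer-level : ∀ j → Level {n} (+ j) (layer j)
  layer-level zero    []            = refl
  layer-level (suc j) []            = sym (ℤ.*-zeroʳ (+ suc j))
  layer-level zero    (outside ∷ A) = layer-level zero A
  layer-level (suc j) (outside ∷ A) = layer-level (suc j) A
  layer-level zero    (inside  ∷ A) = ℤ.*-zeroʳ (+ suc ∣ A ∣)
  layer-level (suc j) (inside  ∷ A) =
    trans (ℤ.suc-* (+ ∣ A ∣) (layer j A))
          (trans (cong (λ s → layer j A + s) (layer-level j A)) (sym (ℤ.suc-* (+ j) (layer j A))))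

  layer-nonneg : ∀ j (A : Subset n) → 0ℤ ≤ layer j A
  layer-nonneg zero    []            = +≤+ ℕ.z≤n
  layer-nonneg (suc j) []            = +≤+ ℕ.z≤n
  layer-nonneg zero    (outside ∷ A) = layer-nonneg zero A
  layer-nonneg (suc j) (outside ∷ A) = layer-nonneg (suc j) A
  layer-nonneg zero    (inside  ∷ A) = +≤+ ℕ.z≤n
  layer-nonneg (suc j) (inside  ∷ A) = layer-nonneg j A

  -- The coefficient is the size of `B` because this form survives the recursion on `B`; the
  -- constant of `up-layer` follows since the right side lives on one layer.
  up-layer-rank : ∀ j (B : Subset n) → up (layer j) B ≡ + ∣ B ∣ * layer (suc j) B
  up-layer-rank j       []            = refl
  up-layer-rank zero    (outside ∷ B) = up-layer-rank zero B
  up-layer-rank (suc j) (outside ∷ B) = up-layer-rank (suc j) B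
  up-layer-rank zero    (inside  ∷ B) = begin
    up (λ _ → 0ℤ) B + layer 0 B            ≡⟨ cong (_+ layer 0 B) (up-* 0ℤ (layer 0) B) ⟩
    0ℤ + layer 0 B                         ≡⟨ ℤ.+-comm 0ℤ (layer 0 B) ⟩
    layer 0 B + 0ℤ                         ≡⟨ cong (λ s → layer 0 B + s) (layer-level 0 B) ⟨
    layer 0 B + + ∣ B ∣ * layer 0 B        ≡⟨ ℤ.suc-* (+ ∣ B ∣) (layer 0 B) ⟨
    (1ℤ + + ∣ B ∣) * layer 0 B             ∎
    where open ≡-Reasoning
  up-layer-rank (suc j) (inside ∷ B) =
    trans (cong (_+ layer (suc j) B) (up-layer-rank j B))
          (trans (ℤ.+-comm _ (layer (suc j) B)) (sym (ℤ.suc-* (+ ∣ B ∣) (layer (suc j) B))))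

  up-layer : ∀ j (B : Subset n) → up (layer j) B ≡ + suc j * layer (suc j) B
  up-layer j B = trans (up-layer-rank j B) (layer-level (suc j) B)

  down-layer-0 : (A : Subset n) → down (layer 0) A ≡ 0ℤ
  down-layer-0 A = ℤ.*-cancelˡ-≡ (+ suc ∣ A ∣) _ 0ℤ (begin
    + suc ∣ A ∣ * down (layer 0) A        ≡⟨ down-rank (layer 0) A ⟩
    down (λ B → + ∣ B ∣ * layer 0 B) A    ≡⟨ down-cong (layer-level 0) A ⟩
    down (λ B → 0ℤ * layer 0 B) A         ≡⟨ down-* 0ℤ (layer 0) A ⟩
    0ℤ                                    ≡⟨ ℤ.*-zeroʳ (+ suc ∣ A ∣) ⟨
    + suc ∣ A ∣ * 0ℤ                      ∎)
    where open ≡-Reasoning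

  down-layer-rank : ∀ j (A : Subset n) → down (layer (suc j)) A ≡ (+ n - + ∣ A ∣) * layer j A
  down-layer-rank j []                    = refl
  down-layer-rank {suc n} j (outside ∷ A) =
    trans (cong (_+ layer j A) (down-layer-rank j A)) (ring-id (+ n) (+ ∣ A ∣) (layer j A))
    where
    ring-id : ∀ n a x → (n - a) * x + x ≡ ((1ℤ + n) - a) * x
    ring-id = solve-∀
  down-layer-rank {suc n} zero (inside ∷ A) =
    trans (down-layer-0 A) (sym (ℤ.*-zeroʳ (+ suc n - + suc ∣ A ∣)))
  down-layer-rank {suc n} (suc j) (inside ∷ A) =
    trans (down-layer-rank j A) (cong (_* layer j A) (ring-id (+ n) (+ ∣ A ∣)))
    where
    ring-id : ∀ n a → n - a ≡ (1ℤ + n) - (1ℤ + a)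
    ring-id = solve-∀

  down-layer : ∀ j (A : Subset n) → down (layer (suc j)) A ≡ (+ n - + j) * layer j A
  down-layer {n} j A = begin
    down (layer (suc j)) A                    ≡⟨ down-layer-rank j A ⟩
    (+ n - + ∣ A ∣) * layer j A               ≡⟨ expand (+ n) (+ ∣ A ∣) (layer j A) ⟩
    + n * layer j A - + ∣ A ∣ * layer j A     ≡⟨ cong (λ s → + n * layer j A - s) (layer-level j A) ⟩
    + n * layer j A - + j * layer j A         ≡⟨ expand (+ n) (+ j) (layer j A) ⟨
    (+ n - + j) * layer j A                   ∎
    where
    open ≡-Reasoning
    expand : ∀ n a x → (n - a) * x ≡ n * x - a * x
    expand = solve-∀

  ∑-layer : ∀ n j → ∑ {n} (layer j) ≡ + (n C j)
  ∑-layer zero    zero    = refl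
  ∑-layer zero    (suc j) = cong +_ (sym (k>n⇒nCk≡0 (ℕ.s≤s (ℕ.z≤n {j}))))
  ∑-layer (suc n) zero    = cong₂ _+_ (∑-layer n zero) (∑-zero {n})
  ∑-layer (suc n) (suc j) = begin
    ∑ {n} (layer (suc j)) + ∑ {n} (layer j)  ≡⟨ cong₂ _+_ (∑-layer n (suc j)) (∑-layer n j) ⟩
    + (n C suc j ℕ.+ n C j)                  ≡⟨ cong +_ (ℕ.+-comm (n C suc j) (n C j)) ⟩
    + (n C j ℕ.+ n C suc j)                  ≡⟨ cong +_ (nCk+nC[k+1]≡[n+1]C[k+1] n j) ⟩
    + (suc n C suc j)                        ∎
    where open ≡-Reasoning

  ∑-layer-positive : ∀ {n j} → j ℕ.≤ n → 1ℤ ≤ ∑ {n} (layer j)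
  ∑-layer-positive {zero}  {zero}  _ = ℤ.≤-refl
  ∑-layer-positive {suc n} {zero}  _ = ℤ.+-mono-≤ (∑-layer-positive {n} {0} ℕ.z≤n)
    (ℤ.≤-reflexive (sym (∑-zero {n})))
  ∑-layer-positive {suc n} {suc j} (ℕ.s≤s j≤n) =
    ℤ.+-mono-≤ (∑-nonneg {n} (layer-nonneg (suc j))) (∑-layer-positive j≤n)

  ⟨,⟩-layer : ∀ j {f : Subset n → ℤ} → Level (+ j) f → ⟨ f , layer j ⟩ ≡ ∑ f
  ⟨,⟩-layer j {f} lf = ∑-cong pointwise
    where
    pointwise : ∀ A → f A * layer j A ≡ f A
    pointwise A with ∣ A ∣ ℕ.≟ j
    ... | yes refl = trans (cong (f A *_) (layer-on A)) (ℤ.*-identityʳ (f A))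
    ... | no  ∣A∣≢j = trans (cong (_* layer j A) fA≡0) (sym fA≡0)
      where
      fA≡0 = off-level j lf A ∣A∣≢j

  -- The second moment of the two-step up operator.

  module _ (k : ℕ) where
    private
      K : ℤ
      K = + k

      -- The eigenvalue of two steps up and two steps down at `layer k` for ν = n: going up
      -- contributes k + 1 and k + 2, coming down n - k - 1 and n - k.
      Λ : ℤ → ℤ
      Λ ν = (1ℤ + K) * ((1ℤ + (1ℤ + K)) * ((ν - (1ℤ + K)) * (ν - K)))

    layer-eigenvector : (A : Subset n) → down (down (up (up (layer k)))) A ≡ Λ (+ n) * layer k A
    layer-eigenvector {n} A = begin
      down (down (up (up (layer k)))) A
        ≡⟨ down-cong (down-cong up-up-layer) A ⟩
      down (down (λ B → (c * d) * layer (suc (suc k)) B)) A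
        ≡⟨ down-cong (λ B → trans (down-* (c * d) (layer (suc (suc k))) B) (cong (c * d *_) (down-layer (suc k) B))) A ⟩
      down (λ B → (c * d) * (e * layer (suc k) B)) A
        ≡⟨ down-cong (λ B → sym (ℤ.*-assoc (c * d) e (layer (suc k) B))) A ⟩
      down (λ B → ((c * d) * e) * layer (suc k) B) A
        ≡⟨ trans (down-* ((c * d) * e) (layer (suc k)) A) (cong ((c * d) * e *_) (down-layer k A)) ⟩
      ((c * d) * e) * ((+ n - K) * layer k A)
        ≡⟨ assoc c d e (+ n - K) (layer k A) ⟩
      (c * (d * (e * (+ n - K)))) * layer k A ∎
      where
      open ≡-Reasoning
      c = + suc k
      d = + suc (suc k)
      e = + n - + suc k
      up-up-layer : ∀ B → up (up (layer k)) B ≡ (c * d) * layer (suc (suc k)) B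
      up-up-layer B = trans (up-cong (up-layer k) B) (trans (up-* c (layer (suc k)) B)
        (trans (cong (c *_) (up-layer (suc k) B)) (sym (ℤ.*-assoc c d (layer (suc (suc k)) B)))))
      assoc : ∀ c d e g x → ((c * d) * e) * (g * x) ≡ (c * (d * (e * g))) * x
      assoc = solve-∀

    -- Moving both `up` operators across by adjointness meets an eigenvector, so the product depends
    -- on `f` only through its sum. It serves for the cross term and, with `f` equal to `layer k`,
    -- for the norm of the constant part.
    ⟨up-up,up-up-layer⟩ : {f : Subset n → ℤ} → Level K f →
      ⟨ up (up f) , up (up (layer k)) ⟩ ≡ Λ (+ n) * ∑ f
    ⟨up-up,up-up-layer⟩ {n} {f} lf = begin
      ⟨ up (up f) , up (up (layer k)) ⟩            ≡⟨ adjoint (up f) (up (up (layer k))) ⟩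
      ⟨ up f , down (up (up (layer k))) ⟩          ≡⟨ adjoint f (down (up (up (layer k)))) ⟩
      ⟨ f , down (down (up (up (layer k)))) ⟩      ≡⟨ ⟨,⟩-cong {f = f} (λ _ → refl) layer-eigenvector ⟩
      ⟨ f , (λ A → Λ (+ n) * layer k A) ⟩          ≡⟨ ⟨,⟩-*ʳ (Λ (+ n)) f (layer k) ⟩
      Λ (+ n) * ⟨ f , layer k ⟩                    ≡⟨ cong (Λ (+ n) *_) (⟨,⟩-layer k lf) ⟩
      Λ (+ n) * ∑ f                                ∎
      where open ≡-Reasoning

    -- Removing the mean and applying `poincaré` twice gives N X ≤ (K + 1) K (K - 1) ((K - 2) N + 4
    -- a) a, and 2 a ≤ N turns 4 a into 2 N. Equality holds when `f` is the indicator of the k-sets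
    -- through a fixed point.
    ∥up-up∥²≤ : 2 ℕ.≤ k → + n ≡ + 2 * K → {f : Subset n → ℤ} → Level K f →
      (∀ A → f A * f A ≡ f A) → + 2 * ∑ f ≤ ∑ {n} (layer k) →
      ∥ up (up f) ∥² ≤ K * K * (K * K - 1ℤ) * ∑ f
    ∥up-up∥²≤ {n} (ℕ.s≤s (ℕ.s≤s {n = k′} _)) n≡2K {f} lf f²≡f 2a≤N =
      *-cancelˡ 1≤N (*-cancelˡ 1≤N (≤-by-difference
        (+-nonneg (ℤ.i≤j⇒0≤j-i variance)
          (*-nonneg (*-nonneg (*-nonneg 0≤N 0≤a) 0≤c) (ℤ.i≤j⇒0≤j-i 2a≤N)))
        (combine K N a X)))
      where
      N = ∑ {n} (layer k)
      a = ∑ f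
      X = ∥ up (up f) ∥²
      -- The mean-zero part of `f`, multiplied by `N` to stay within the integers.
      h : Subset n → ℤ
      h A = N * f A + (- a) * layer k A

      n≡k+k : n ≡ k ℕ.+ k
      n≡k+k = ℤ.+-injective (trans n≡2K (double K))
        where
        double : ∀ x → + 2 * x ≡ x + x
        double = solve-∀
      -- The second use of `poincaré` is at level k + 1, which lies below n = 2k because 2 ≤ k.
      k+1<n : suc k ℕ.< n
      k+1<n = subst (suc (suc k) ℕ.≤_) (sym n≡k+k) (ℕ.+-monoˡ-≤ k (ℕ.s≤s (ℕ.s≤s (ℕ.z≤n {k′}))))
      k<n : k ℕ.< n
      k<n = ℕ.<-trans (ℕ.n<1+n k) k+1<n

      1≤N : 1ℤ ≤ N
      1≤N = ∑-layer-positive (ℕ.<⇒≤ k<n)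
      0≤N : 0ℤ ≤ N
      0≤N = ∑-nonneg {n} (layer-nonneg k)
      0≤a : 0ℤ ≤ a
      0≤a = ∑-nonneg (λ A → subst (0ℤ ≤_) (f²≡f A) (square-nonneg (f A)))
      0≤c : 0ℤ ≤ + 2 * ((K + 1ℤ) * K * (K - 1ℤ))
      0≤c = +≤+ ℕ.z≤n

      h-level : Level K h
      h-level = linear-level K N (- a) lf (layer-level k)
      ∑h≡0 : ∑ h ≡ 0ℤ
      ∑h≡0 = trans (∑-linear N (- a) f (layer k)) (cancel N a)
        where
        cancel : ∀ x y → x * y + (- y) * x ≡ 0ℤ
        cancel = solve-∀
      ∑uh≡0 : ∑ (up h) ≡ 0ℤ
      ∑uh≡0 = trans (∑-up-level K h-level) (trans (cong ((+ n - K) *_) ∑h≡0) (ℤ.*-zeroʳ (+ n - K)))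

      0≤gap : 0ℤ ≤ (1ℤ + K) * (+ n - 1ℤ - (1ℤ + K))
      0≤gap = *-nonneg {1ℤ + K} (+≤+ ℕ.z≤n)
        (subst (0ℤ ≤_) (rearrange (+ n) K) (ℤ.i≤j⇒0≤j-i (+≤+ k+1<n)))
        where
        rearrange : ∀ n k → n - (1ℤ + (1ℤ + k)) ≡ n - 1ℤ - (1ℤ + k)
        rearrange = solve-∀

      ∥uuh∥² : ∥ up (up h) ∥² ≡ N * N * X + + 2 * (N * (- a)) * (Λ (+ n) * a) + (- a) * (- a) * (Λ (+ n) * N)
      ∥uuh∥² = begin
        ∥ up (up h) ∥²
          ≡⟨ ⟨,⟩-cong uuh uuh ⟩
        ∥ (λ B → N * up (up f) B + (- a) * up (up (layer k)) B) ∥²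
          ≡⟨ ∥∥²-linear N (- a) (up (up f)) (up (up (layer k))) ⟩
        N * N * X + + 2 * (N * (- a)) * ⟨ up (up f) , up (up (layer k)) ⟩ + (- a) * (- a) * ∥ up (up (layer {n} k)) ∥²
          ≡⟨ cong₂ (λ s t → N * N * X + + 2 * (N * (- a)) * s + (- a) * (- a) * t)
               (⟨up-up,up-up-layer⟩ lf) (⟨up-up,up-up-layer⟩ {n} (layer-level k)) ⟩
        N * N * X + + 2 * (N * (- a)) * (Λ (+ n) * a) + (- a) * (- a) * (Λ (+ n) * N) ∎
        where
        open ≡-Reasoning
        uuh : ∀ B → up (up h) B ≡ N * up (up f) B + (- a) * up (up (layer k)) B
        uuh B = trans (up-cong (up-linear N (- a) f (layer k)) B) (up-linear N (- a) (up f) (up (layer k)) B)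

      ∥h∥² : ∥ h ∥² ≡ N * N * a + + 2 * (N * (- a)) * a + (- a) * (- a) * N
      ∥h∥² = trans (∥∥²-linear N (- a) f (layer k))
        (trans (cong (λ s → N * N * s + + 2 * (N * (- a)) * ⟨ f , layer k ⟩ + (- a) * (- a) * ∥ layer {n} k ∥²)
               (∑-cong f²≡f))
          (cong₂ (λ s t → N * N * a + + 2 * (N * (- a)) * s + (- a) * (- a) * t)
            (⟨,⟩-layer k lf) (⟨,⟩-layer k {layer {n} k} (layer-level k))))

      -- The gap is used at level k + 1 for `up h` and then at level k for `h`.
      spectral : ∥ up (up h) ∥² ≤ (1ℤ + K) * (+ n - 1ℤ - (1ℤ + K)) * (K * (+ n - 1ℤ - K) * ∥ h ∥²)
      spectral = ℤ.≤-trans (poincaré k k+1<n (up-level K h-level) ∑uh≡0)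
        (*-monoˡ 0≤gap (poincaré (suc k′) k<n h-level ∑h≡0))

      -- Abstracting `+ n` to ν lets one `subst` put `+ 2 * K` in all its places, after which the
      -- ring solver can finish.
      Variance : ℤ → Set
      Variance ν = N * N * X + + 2 * (N * (- a)) * (Λ ν * a) + (- a) * (- a) * (Λ ν * N)
        ≤ (1ℤ + K) * (ν - 1ℤ - (1ℤ + K)) 
          * (K * (ν - 1ℤ - K) * (N * N * a + + 2 * (N * (- a)) * a + (- a) * (- a) * N))

      variance : Variance (+ 2 * K)
      variance = subst Variance n≡2K
        (subst₂ (λ s t → s ≤ (1ℤ + K) * (+ n - 1ℤ - (1ℤ + K)) * (K * (+ n - 1ℤ - K) * t))
          ∥uuh∥² ∥h∥² spectral)

      combine : ∀ K N a X →
        N * (N * (K * K * (K * K - 1ℤ) * a)) ≡ N * (N * X) +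
          (((1ℤ + K) * (+ 2 * K - 1ℤ - (1ℤ + K))
            * (K * (+ 2 * K - 1ℤ - K) * (N * N * a + + 2 * (N * (- a)) * a + (- a) * (- a) * N))
            - (N * N * X + + 2 * (N * (- a)) * ((1ℤ + K) * ((1ℤ + (1ℤ + K)) * ((+ 2 * K - (1ℤ + K)) * (+ 2 * K - K))) * a)
               + (- a) * (- a) * ((1ℤ + K) * ((1ℤ + (1ℤ + K)) * ((+ 2 * K - (1ℤ + K)) * (+ 2 * K - K))) * N)))
          + N * a * (+ 2 * ((K + 1ℤ) * K * (K - 1ℤ))) * (N - + 2 * a))
      combine = solve-∀

  -- Indicator functions of collections

  _∈?_ : (A : Subset n) (L : List (Subset n)) → Dec (A ∈ L)
  A ∈? L = any? (Vec.≡-dec Bool._≟_ A) L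

  up-vanish : {f : Subset n → ℤ} (B : Subset n) → (∀ {A} → A ⊂ B → f A ≡ 0ℤ) → up f B ≡ 0ℤ
  up-vanish []            f≡0 = refl
  up-vanish (outside ∷ B) f≡0 = up-vanish B (f≡0 ∘ s⊂s)
  up-vanish (inside  ∷ B) f≡0 = cong₂ _+_ (up-vanish B (f≡0 ∘ s⊂s)) (f≡0 (out⊂in ⊆-refl))

  up-zero : (B : Subset n) → up (λ _ → 0ℤ) B ≡ 0ℤ
  up-zero B = up-vanish B (λ _ → refl)

  layer-off : ∀ j (A : Subset n) → ∣ A ∣ ≢ j → layer j A ≡ 0ℤ
  layer-off {n} j = off-level j (layer-level {n} j)

  layer≤1 : ∀ j (A : Subset n) → layer j A ≤ 1ℤ
  layer≤1 j A with ∣ A ∣ ℕ.≟ j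
  ... | yes refl  = ℤ.≤-reflexive (layer-on A)
  ... | no  ∣A∣≢j = ℤ.≤-trans (ℤ.≤-reflexive (layer-off j A ∣A∣≢j)) (+≤+ ℕ.z≤n)

  layer-idem : ∀ j (A : Subset n) → layer j A * layer j A ≡ layer j A
  layer-idem j A with ∣ A ∣ ℕ.≟ j
  ... | yes refl  = trans (cong (_* layer j A) (layer-on A)) (ℤ.*-identityˡ (layer j A))
  ... | no  ∣A∣≢j = trans (cong (_* layer j A) (layer-off j A ∣A∣≢j)) (sym (layer-off j A ∣A∣≢j))

  layers-disjoint : ∀ j (A : Subset n) → layer j A + layer (suc j) A ≤ 1ℤ
  layers-disjoint j A with ∣ A ∣ ℕ.≟ j
  ... | yes refl  = ℤ.≤-reflexive (cong₂ _+_ (layer-on A) (layer-off (suc j) A (ℕ.<⇒≢ (ℕ.n<1+n ∣ A ∣))))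
  ... | no  ∣A∣≢j = ℤ.+-mono-≤ (ℤ.≤-reflexive (layer-off j A ∣A∣≢j)) (layer≤1 (suc j) A)

  δ : Subset n → Subset n → ℤ
  δ []            []            = 1ℤ
  δ (outside ∷ x) (outside ∷ A) = δ x A
  δ (outside ∷ x) (inside  ∷ A) = 0ℤ
  δ (inside  ∷ x) (outside ∷ A) = 0ℤ
  δ (inside  ∷ x) (inside  ∷ A) = δ x A

  δ-refl : (x : Subset n) → δ x x ≡ 1ℤ
  δ-refl []            = refl
  δ-refl (outside ∷ x) = δ-refl x
  δ-refl (inside  ∷ x) = δ-refl x

  δ-off : (x A : Subset n) → x ≢ A → δ x A ≡ 0ℤ
  δ-off []            []            x≢A = contradiction refl x≢A
  δ-off (outside ∷ x) (outside ∷ A) x≢A = δ-off x A (x≢A ∘ cong (outside ∷_))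
  δ-off (outside ∷ x) (inside  ∷ A) x≢A = refl
  δ-off (inside  ∷ x) (outside ∷ A) x≢A = refl
  δ-off (inside  ∷ x) (inside  ∷ A) x≢A = δ-off x A (x≢A ∘ cong (inside ∷_))

  δ≤1 : (x A : Subset n) → δ x A ≤ 1ℤ
  δ≤1 x A with Vec.≡-dec Bool._≟_ x A
  ... | yes refl = ℤ.≤-reflexive (δ-refl x)
  ... | no  x≢A  = ℤ.≤-trans (ℤ.≤-reflexive (δ-off x A x≢A)) (+≤+ ℕ.z≤n)

  ∑-δ : (x : Subset n) → ∑ (δ x) ≡ 1ℤ
  ∑-δ []                    = refl
  ∑-δ {suc n} (outside ∷ x) = cong₂ _+_ (∑-δ x) (∑-zero {n})
  ∑-δ {suc n} (inside  ∷ x) = cong₂ _+_ (∑-zero {n}) (∑-δ x)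

  up-δ≤1 : (x B : Subset n) → up (δ x) B ≤ 1ℤ
  up-δ≤1 []            []            = +≤+ ℕ.z≤n
  up-δ≤1 (outside ∷ x) (outside ∷ B) = up-δ≤1 x B
  up-δ≤1 (inside  ∷ x) (outside ∷ B) = ℤ.≤-trans (ℤ.≤-reflexive (up-zero B)) (+≤+ ℕ.z≤n)
  up-δ≤1 (outside ∷ x) (inside  ∷ B) = ℤ.+-mono-≤ (ℤ.≤-reflexive (up-zero B)) (δ≤1 x B)
  up-δ≤1 (inside  ∷ x) (inside  ∷ B) = ℤ.+-mono-≤ (up-δ≤1 x B) (ℤ.≤-refl {0ℤ})

  -- Two missing elements can be added to `x` in two orders.
  up-up-δ≤2 : (x B : Subset n) → up (up (δ x)) B ≤ + 2
  up-up-δ≤2 []            []            = +≤+ ℕ.z≤n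
  up-up-δ≤2 (outside ∷ x) (outside ∷ B) = up-up-δ≤2 x B
  up-up-δ≤2 (inside  ∷ x) (outside ∷ B) =
    ℤ.≤-trans (ℤ.≤-reflexive (trans (up-cong up-zero B) (up-zero B))) (+≤+ ℕ.z≤n)
  up-up-δ≤2 (outside ∷ x) (inside  ∷ B) =
    ℤ.+-mono-≤ (ℤ.≤-trans (ℤ.≤-reflexive (up-cong (λ A → trans (cong (_+ δ x A) (up-zero A)) (ℤ.+-identityˡ (δ x A))) B))
                          (up-δ≤1 x B))
               (up-δ≤1 x B)
  up-up-δ≤2 (inside  ∷ x) (inside  ∷ B) =
    ℤ.≤-trans (ℤ.≤-reflexive (trans (cong₂ _+_ (up-cong (λ A → ℤ.+-identityʳ (up (δ x) A)) B) (up-zero B))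
                                    (ℤ.+-identityʳ _)))
              (up-up-δ≤2 x B)

  -- Counts the occurrences of `A`, which is additive in the list; for a list without repetition it
  -- is the indicator function.
  χ : List (Subset n) → Subset n → ℤ
  χ []      A = 0ℤ
  χ (x ∷ L) A = δ x A + χ L A

  ∑-χ : (L : List (Subset n)) → ∑ (χ L) ≡ + length L
  ∑-χ {n} []  = ∑-zero {n}
  ∑-χ (x ∷ L) = trans (∑-+ (δ x) (χ L)) (cong₂ _+_ (∑-δ x) (∑-χ L))

  χ-∉ : (L : List (Subset n)) {A : Subset n} → A ∉ L → χ L A ≡ 0ℤ
  χ-∉ []          A∉L = refl
  χ-∉ (x ∷ L) {A} A∉L =
    cong₂ _+_ (δ-off x A (λ x≡A → A∉L (here (sym x≡A)))) (χ-∉ L (A∉L ∘ there))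

  χ-∈ : {L : List (Subset n)} → Unique L → {A : Subset n} → A ∈ L → χ L A ≡ 1ℤ
  χ-∈ {L = x ∷ L} (x∉L ∷ _) (here refl) =
    cong₂ _+_ (δ-refl x) (χ-∉ L (λ x∈L → All.lookup x∉L x∈L refl))
  χ-∈ {L = x ∷ L} (x∉L ∷ u) {A} (there A∈L) =
    cong₂ _+_ (δ-off x A (All.lookup x∉L A∈L)) (χ-∈ u A∈L)

  ∑-∁ : (f : Subset n → ℤ) → ∑ (f ∘ ∁) ≡ ∑ f
  ∑-∁ {zero}  f = refl
  ∑-∁ {suc n} f =
    trans (cong₂ _+_ (∑-∁ (f ∘ (inside ∷_))) (∑-∁ (f ∘ (outside ∷_))))
          (ℤ.+-comm (∑ (f ∘ (inside ∷_))) (∑ (f ∘ (outside ∷_))))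

  slice : ℕ → List (Subset n) → Subset n → ℤ
  slice j L A = layer j A * χ L A

  -- Away from `x` both sides vanish. The layer factor thus becomes a constant that can be pulled
  -- out of `up`.
  layer-δ : ∀ j (x A : Subset n) → layer j A * δ x A ≡ layer j x * δ x A
  layer-δ j x A with Vec.≡-dec Bool._≟_ x A
  ... | yes refl = refl
  ... | no  x≢A  = trans (vanish (layer j A)) (sym (vanish (layer j x)))
    where
    vanish : ∀ c → c * δ x A ≡ 0ℤ
    vanish c = trans (cong (c *_) (δ-off x A x≢A)) (ℤ.*-zeroʳ c)

  slice-∷ : ∀ j (x : Subset n) L A → slice j (x ∷ L) A ≡ layer j x * δ x A + slice j L A
  slice-∷ j x L A = trans (ℤ.*-distribˡ-+ (layer j A) (δ x A) (χ L A)) (cong (_+ slice j L A) (layer-δ j x A))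

  slice-level : ∀ j (L : List (Subset n)) → Level (+ j) (slice j L)
  slice-level j L A = trans (sym (ℤ.*-assoc (+ ∣ A ∣) (layer j A) (χ L A)))
    (trans (cong (_* χ L A) (layer-level j A)) (ℤ.*-assoc (+ j) (layer j A) (χ L A)))

  up-slice-∷ : ∀ j (x : Subset n) L B → up (slice j (x ∷ L)) B ≡ layer j x * up (δ x) B + up (slice j L) B
  up-slice-∷ j x L B = trans (up-cong (slice-∷ j x L) B)
    (trans (up-+ (λ A → layer j x * δ x A) (slice j L) B) (cong (_+ up (slice j L) B) (up-* (layer j x) (δ x) B)))

  up-up-slice-∷ : ∀ j (x : Subset n) L B →
    up (up (slice j (x ∷ L))) B ≡ layer j x * up (up (δ x)) B + up (up (slice j L)) B
  up-up-slice-∷ j x L B = trans (up-cong (up-slice-∷ j x L) B)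
    (trans (up-+ (λ A → layer j x * up (δ x) A) (up (slice j L)) B)
           (cong (_+ up (up (slice j L)) B) (up-* (layer j x) (up (δ x)) B)))

  -- Two sets lie strictly between B and a set two levels below it, hence the factors 2.
  slices-below : ∀ j (L : List (Subset n)) B →
    up (up (slice j L)) B + + 2 * up (slice (suc j) L) B ≤ + 2 * + length (filter (_⊂? B) L)
  slices-below j [] B = ℤ.≤-reflexive (cong₂ (λ s t → s + + 2 * t)
    (trans (up-cong (λ A → trans (up-cong (λ A′ → ℤ.*-zeroʳ (layer j A′)) A) (up-zero A)) B) (up-zero B))
    (trans (up-cong (λ A → ℤ.*-zeroʳ (layer (suc j) A)) B) (up-zero B)))
  slices-below j (x ∷ L) B with x ⊂? B
  ... | yes x⊂B = begin
    up (up (slice j (x ∷ L))) B + + 2 * up (slice (suc j) (x ∷ L)) B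
      ≡⟨ cong₂ (λ s t → s + + 2 * t) (up-up-slice-∷ j x L B) (up-slice-∷ (suc j) x L B) ⟩
    (c * u + v) + + 2 * (d * s + t)
      -- The set `x` contributes at most 2 (c + d), and c + d ≤ 1 because it lies in at most one of
      -- the two layers.
      ≤⟨ ≤-by-difference
           (+-nonneg (+-nonneg (*-nonneg (layer-nonneg j x) (ℤ.i≤j⇒0≤j-i (up-up-δ≤2 x B)))
                               (*-nonneg {+ 2} (+≤+ ℕ.z≤n) (*-nonneg (layer-nonneg (suc j) x) (ℤ.i≤j⇒0≤j-i (up-δ≤1 x B)))))
             (+-nonneg (*-nonneg {+ 2} (+≤+ ℕ.z≤n) (ℤ.i≤j⇒0≤j-i (layers-disjoint j x)))
                       (ℤ.i≤j⇒0≤j-i (slices-below j L B))))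
           (ring-id c d u s v t l) ⟩
    + 2 * (1ℤ + l) ∎
    where
    open ≤-Reasoning
    c = layer j x
    d = layer (suc j) x
    u = up (up (δ x)) B
    s = up (δ x) B
    v = up (up (slice j L)) B
    t = up (slice (suc j) L) B
    l = + length (filter (_⊂? B) L)
    ring-id : ∀ c d u s v t l → + 2 * (1ℤ + l) ≡ ((c * u + v) + + 2 * (d * s + t))
      + ((c * (+ 2 - u) + + 2 * (d * (1ℤ - s))) + (+ 2 * (1ℤ - (c + d)) + (+ 2 * l - (v + + 2 * t))))
    ring-id = solve-∀
  ... | no x⊄B = begin
    up (up (slice j (x ∷ L))) B + + 2 * up (slice (suc j) (x ∷ L)) B
      ≡⟨ cong₂ (λ s t → s + + 2 * t) (up-up-slice-∷ j x L B) (up-slice-∷ (suc j) x L B) ⟩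
    (layer j x * up (up (δ x)) B + v) + + 2 * (layer (suc j) x * up (δ x) B + t)
      ≡⟨ cong₂ (λ p q → (p + v) + + 2 * (q + t))
          (trans (cong (layer j x *_) (up-vanish B (λ {A} A⊂B → up-vanish A (λ A′⊂A → δ≡0 (⊂-trans A′⊂A A⊂B)))))
                 (ℤ.*-zeroʳ (layer j x)))
          (trans (cong (layer (suc j) x *_) (up-vanish B δ≡0)) (ℤ.*-zeroʳ (layer (suc j) x))) ⟩
    (0ℤ + v) + + 2 * (0ℤ + t)
      ≡⟨ cong₂ (λ p q → p + + 2 * q) (ℤ.+-identityˡ v) (ℤ.+-identityˡ t) ⟩
    v + + 2 * t
      ≤⟨ slices-below j L B ⟩
    + 2 * + length (filter (_⊂? B) L) ∎
    where
    open ≤-Reasoning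
    v = up (up (slice j L)) B
    t = up (slice (suc j) L) B
    δ≡0 : ∀ {A} → A ⊂ B → δ x A ≡ 0ℤ
    δ≡0 {A} A⊂B = δ-off x A (λ { refl → x⊄B A⊂B })

  -- Intersecting temperate collections

  χ≤1 : {L : List (Subset n)} → Unique L → ∀ A → χ L A ≤ 1ℤ
  χ≤1 {L = L} u A with A ∈? L
  ... | yes A∈L = ℤ.≤-reflexive (χ-∈ u A∈L)
  ... | no  A∉L = ℤ.≤-trans (ℤ.≤-reflexive (χ-∉ L A∉L)) (+≤+ ℕ.z≤n)

  slice-idem : ∀ j {L : List (Subset n)} → Unique L → ∀ A → slice j L A * slice j L A ≡ slice j L A
  slice-idem j {L} u A =
    trans (regroup (layer j A) (χ L A)) (cong₂ _*_ (layer-idem j A) χ-idem)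
    where
    regroup : ∀ x y → (x * y) * (x * y) ≡ (x * x) * (y * y)
    regroup = solve-∀
    χ-idem : χ L A * χ L A ≡ χ L A
    χ-idem with A ∈? L
    ... | yes A∈L = trans (cong (_* χ L A) (χ-∈ u A∈L)) (ℤ.*-identityˡ (χ L A))
    ... | no  A∉L = trans (cong (_* χ L A) (χ-∉ L A∉L)) (sym (χ-∉ L A∉L))

  slice-off : ∀ j (L : List (Subset n)) A → ∣ A ∣ ≢ j → slice j L A ≡ 0ℤ
  slice-off j L = off-level j (slice-level j L)

  slice-on : (L : List (Subset n)) (A : Subset n) → slice ∣ A ∣ L A ≡ χ L A
  slice-on L A = trans (cong (_* χ L A) (layer-on A)) (ℤ.*-identityˡ (χ L A))

  -- The difference factors as `layer j A * (1ℤ - χ L A)`, the indicator of the j-sets missing from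
  -- the list.
  slice-deficit-nonneg : ∀ j {L : List (Subset n)} → Unique L → ∀ A → 0ℤ ≤ layer j A - slice j L A
  slice-deficit-nonneg j {L} u A = subst (0ℤ ≤_) (factor (layer j A) (χ L A))
    (*-nonneg (layer-nonneg j A) (ℤ.i≤j⇒0≤j-i (χ≤1 u A)))
    where
    factor : ∀ x y → x * (1ℤ - y) ≡ x - x * y
    factor = solve-∀

  -- Complementation preserves the middle layer, and a set and its complement, being disjoint,
  -- cannot both belong to an intersecting collection.
  middle-slice : ∀ {k} → n ≡ k ℕ.+ k → (𝒜 : Collection n) → Intersecting 𝒜 →
    + 2 * ∑ (slice k (members 𝒜)) ≤ ∑ {n} (layer k)
  middle-slice {n} {k} n≡k+k 𝒜 int = begin
    + 2 * ∑ f                      ≡⟨ double (∑ f) ⟩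
    ∑ f + ∑ f                      ≡⟨ cong (λ s → ∑ f + s) (∑-∁ f) ⟨
    ∑ f + ∑ (f ∘ ∁)                ≡⟨ ∑-+ f (f ∘ ∁) ⟨
    ∑ (λ A → f A + f (∁ A))        ≤⟨ ∑-mono pair ⟩
    ∑ {n} (layer k)                ∎
    where
    open ≤-Reasoning
    L = members 𝒜
    u = unique 𝒜
    f = slice k L
    double : ∀ x → + 2 * x ≡ x + x
    double = solve-∀
    f≤1 : ∀ A → f A ≤ 1ℤ
    f≤1 A = ℤ.≤-trans (ℤ.0≤i-j⇒j≤i (slice-deficit-nonneg k u A)) (layer≤1 k A)
    ∉⇒0 : ∀ A → A ∉ L → f A ≡ 0ℤ
    ∉⇒0 A A∉L = trans (cong (layer k A *_) (χ-∉ L A∉L)) (ℤ.*-zeroʳ (layer k A))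
    ∣∁∣ : ∀ A → ∣ ∁ A ∣ ≡ k → ∣ A ∣ ≡ k
    ∣∁∣ A ∣∁A∣≡k = trans (sym (ℕ.m∸[m∸n]≡n (∣p∣≤n A)))
      (trans (cong (n ∸_) (trans (sym (∣∁p∣≡n∸∣p∣ A)) ∣∁A∣≡k))
        (trans (cong (_∸ k) n≡k+k) (ℕ.m+n∸n≡m k k)))
    pair : ∀ A → f A + f (∁ A) ≤ layer k A
    pair A with ∣ A ∣ ℕ.≟ k
    ... | no ∣A∣≢k = ℤ.≤-reflexive (trans
          (cong₂ _+_ (slice-off k L A ∣A∣≢k) (slice-off k L (∁ A) (∣A∣≢k ∘ ∣∁∣ A)))
          (sym (layer-off k A ∣A∣≢k)))
    ... | yes ∣A∣≡k = subst (f A + f (∁ A) ≤_) (sym (subst (λ j → layer j A ≡ 1ℤ) ∣A∣≡k (layer-on A))) bound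
      where
      bound : f A + f (∁ A) ≤ 1ℤ
      bound with A ∈? L | ∁ A ∈? L
      ... | no A∉L  | _        = ℤ.+-mono-≤ (ℤ.≤-reflexive (∉⇒0 A A∉L)) (f≤1 (∁ A))
      ... | yes _   | no ∁A∉L  = ℤ.+-mono-≤ (f≤1 A) (ℤ.≤-reflexive (∉⇒0 (∁ A) ∁A∉L))
      ... | yes A∈L | yes ∁A∈L with int A (∁ A) A∈L ∁A∈L
      ...   | i , i∈A∩∁A with x∈p∩q⁻ A (∁ A) i∈A∩∁A
      ...     | i∈A , i∈∁A = contradiction i∈A (x∈∁p⇒x∉p i∈∁A)

  -- Summing `local` over all `B` bounds 2 M K (K - 1) a - `∥ E ∥²` by M² (G₁ + G₂), up to the
  -- common factor K - 1. The second moment is at most M K (K - 1) a, and cancelling M K leaves the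
  -- claim.
  defect : ∀ {k} → 2 ℕ.≤ k → n ≡ k ℕ.+ k → (𝒜 : Collection n) → Intersecting 𝒜 → Temperate 𝒜 →
    (+ k - 1ℤ) * ∑ (slice k (members 𝒜)) ≤
      (1ℤ + + k) * ((∑ {n} (layer (1 ℕ.+ k)) - ∑ (slice (1 ℕ.+ k) (members 𝒜)))
                  + (∑ {n} (layer (2 ℕ.+ k)) - ∑ (slice (2 ℕ.+ k) (members 𝒜))))
  -- With `k` exposed as `suc (suc k′)` the signs of `K - 1ℤ`, `M` and their products hold by
  -- computation.
  defect {n} {k@(suc (suc k′))} 2≤k@(ℕ.s≤s (ℕ.s≤s _)) n≡k+k 𝒜 int temp =
    *-cancelˡ {M * K} (+≤+ (ℕ.s≤s ℕ.z≤n)) (*-cancelˡ {K - 1ℤ} (+≤+ (ℕ.s≤s ℕ.z≤n)) (≤-by-difference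
      (+-nonneg (ℤ.i≤j⇒0≤j-i summed) (*-nonneg {K - 1ℤ} (+≤+ ℕ.z≤n) (ℤ.i≤j⇒0≤j-i energy)))
      (combine K a G₁ G₂ ∥ E ∥²)))
    where
    L = members 𝒜
    u = unique 𝒜
    K = + k
    M = K * (1ℤ + K)
    f₀ = slice k L
    f₁ = slice (1 ℕ.+ k) L
    f₂ = slice (2 ℕ.+ k) L
    a = ∑ f₀
    E g₁ g₂ m : Subset n → ℤ
    E = up (up f₀)
    g₁ A = layer (1 ℕ.+ k) A - f₁ A
    g₂ A = layer (2 ℕ.+ k) A - f₂ A
    m = up g₁
    G₁ = ∑ {n} (layer (1 ℕ.+ k)) - ∑ f₁
    G₂ = ∑ {n} (layer (2 ℕ.+ k)) - ∑ f₂

    n≡2K : + n ≡ + 2 * K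
    n≡2K = trans (cong +_ n≡k+k) (double K)
      where
      double : ∀ x → x + x ≡ + 2 * x
      double = solve-∀

    energy : ∥ E ∥² ≤ K * K * (K * K - 1ℤ) * a
    energy = ∥up-up∥²≤ k 2≤k n≡2K (slice-level k L) (slice-idem k u) (middle-slice n≡k+k 𝒜 int)

    minus : ∀ x y → x - y ≡ 1ℤ * x + (- 1ℤ) * y
    minus = solve-∀
    g₁-linear : ∀ A → g₁ A ≡ 1ℤ * layer (1 ℕ.+ k) A + (- 1ℤ) * f₁ A
    g₁-linear A = minus (layer (1 ℕ.+ k) A) (f₁ A)

    m-nonneg : ∀ B → 0ℤ ≤ m B
    m-nonneg = up-nonneg (slice-deficit-nonneg (1 ℕ.+ k) u)

    -- A (k+2)-set has exactly k + 2 subsets of size k + 1, as many as temperateness allows it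
    -- proper subsets in 𝒜. Hence every k-set of 𝒜 below `B` is paid for by a missing (k+1)-set, and
    -- `E` counts k-sets twice.
    E≤2m : ∀ B → ∣ B ∣ ≡ 2 ℕ.+ k → B ∈ L → E B ≤ + 2 * m B
    E≤2m B ∣B∣≡k+2 B∈L = ≤-by-difference
      (ℤ.i≤j⇒0≤j-i (ℤ.≤-trans (slices-below k L B)
        (*-monoˡ {+ 2} (+≤+ ℕ.z≤n) (ℤ.≤-trans (+≤+ (temp B B∈L)) (ℤ.≤-reflexive (cong +_ ∣B∣≡k+2))))))
      (trans (cong (+ 2 *_) mB) (rearrange (E B) (up f₁ B) (+ (2 ℕ.+ k))))
      where
      on : layer (2 ℕ.+ k) B ≡ 1ℤ
      on = subst (λ j → layer j B ≡ 1ℤ) ∣B∣≡k+2 (layer-on B)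
      mB : m B ≡ 1ℤ * (+ (2 ℕ.+ k) * 1ℤ) + (- 1ℤ) * up f₁ B
      mB = trans (up-cong g₁-linear B) (trans (up-linear 1ℤ (- 1ℤ) (layer (1 ℕ.+ k)) f₁ B)
        (cong (λ s → 1ℤ * s + (- 1ℤ) * up f₁ B)
          (trans (up-layer (1 ℕ.+ k) B) (cong (+ (2 ℕ.+ k) *_) on))))
      rearrange : ∀ e x c → + 2 * (1ℤ * (c * 1ℤ) + (- 1ℤ) * x) ≡ e + (+ 2 * c - (e + + 2 * x))
      rearrange = solve-∀

    -- E counts every k-set of 𝒜 below B twice; it takes the value M on the sets
    -- containing 1 when the k-sets of 𝒜 are those containing 1. The parabola
    -- 2 M E - E² is at most M², with equality there, and for B ∈ 𝒜 its slope 2 M at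
    -- E = 0 is small enough because E ≤ 2 m and 4 (k - 1) ≤ M.
    local : ∀ B → (K - 1ℤ) * (+ 2 * M * E B - E B * E B) ≤ M * M * ((K - 1ℤ) * g₂ B + m B)
    local B with ∣ B ∣ ℕ.≟ 2 ℕ.+ k | B ∈? L
    ... | no ∣B∣≢k+2 | _ = ≤-by-difference
        (*-nonneg {M * M} (+≤+ ℕ.z≤n) (+-nonneg (*-nonneg {K - 1ℤ} (+≤+ ℕ.z≤n) (slice-deficit-nonneg (2 ℕ.+ k) u B)) (m-nonneg B)))
        (trans (sym (ℤ.+-identityˡ rhs)) (cong (_+ rhs) (sym lhs≡0)))
      where
      rhs = M * M * ((K - 1ℤ) * g₂ B + m B)
      EB≡0 : E B ≡ 0ℤ
      EB≡0 = off-level (2 ℕ.+ k) (up-level (+ (1 ℕ.+ k)) (up-level K (slice-level k L))) B ∣B∣≢k+2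
      zero-case : ∀ x y → x * (y * 0ℤ - 0ℤ * 0ℤ) ≡ 0ℤ
      zero-case = solve-∀
      lhs≡0 : (K - 1ℤ) * (+ 2 * M * E B - E B * E B) ≡ 0ℤ
      lhs≡0 = trans (cong (λ e → (K - 1ℤ) * (+ 2 * M * e - e * e)) EB≡0) (zero-case (K - 1ℤ) (+ 2 * M))
    ... | yes ∣B∣≡k+2 | yes B∈L = ≤-by-difference
        (+-nonneg (+-nonneg (*-nonneg {M * M} (+≤+ ℕ.z≤n) (*-nonneg {K - 1ℤ} (+≤+ ℕ.z≤n) (slice-deficit-nonneg (2 ℕ.+ k) u B)))
                            (*-nonneg {K - 1ℤ} (+≤+ ℕ.z≤n) (square-nonneg (E B))))
          (+-nonneg (*-nonneg {+ 2 * M * (K - 1ℤ)} (+≤+ ℕ.z≤n) (ℤ.i≤j⇒0≤j-i (E≤2m B ∣B∣≡k+2 B∈L)))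
                    (*-nonneg {M} (+≤+ ℕ.z≤n) (*-nonneg {(K - + 2) * (K - + 2) + (K - + 2) + + 2} slope-gap (m-nonneg B)))))
        (in-case K (E B) (g₂ B) (m B))
      where
      -- This is M - 4 (K - 1), rewritten to make its sign visible.
      slope-gap : 0ℤ ≤ (K - + 2) * (K - + 2) + (K - + 2) + + 2
      slope-gap = +-nonneg (+-nonneg (square-nonneg (K - + 2)) (+≤+ ℕ.z≤n)) (+≤+ ℕ.z≤n)
      in-case : ∀ K e g m → (K * (1ℤ + K)) * (K * (1ℤ + K)) * ((K - 1ℤ) * g + m) ≡
        (K - 1ℤ) * (+ 2 * (K * (1ℤ + K)) * e - e * e)
        + ((((K * (1ℤ + K)) * (K * (1ℤ + K))) * ((K - 1ℤ) * g) + (K - 1ℤ) * (e * e))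
          + ((+ 2 * (K * (1ℤ + K)) * (K - 1ℤ)) * (+ 2 * m - e)
            + (K * (1ℤ + K)) * (((K - + 2) * (K - + 2) + (K - + 2) + + 2) * m)))
      in-case = solve-∀
    ... | yes ∣B∣≡k+2 | no B∉L = ≤-by-difference
        (+-nonneg (*-nonneg {K - 1ℤ} (+≤+ ℕ.z≤n) (square-nonneg (M - E B)))
                  (*-nonneg {M * M} (+≤+ ℕ.z≤n) (m-nonneg B)))
        (trans (cong (λ g → M * M * ((K - 1ℤ) * g + m B)) g₂B≡1) (out-case M (K - 1ℤ) (E B) (m B)))
      where
      g₂B≡1 : g₂ B ≡ 1ℤ
      g₂B≡1 = cong₂ _-_ (subst (λ j → layer j B ≡ 1ℤ) ∣B∣≡k+2 (layer-on B))
        (trans (cong (layer (2 ℕ.+ k) B *_) (χ-∉ L B∉L)) (ℤ.*-zeroʳ (layer (2 ℕ.+ k) B)))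
      out-case : ∀ M c e m → M * M * (c * 1ℤ + m) ≡
        c * (+ 2 * M * e - e * e) + (c * ((M - e) * (M - e)) + M * M * m)
      out-case = solve-∀

    ∑-minus : ∀ (f g : Subset n → ℤ) → ∑ (λ A → f A - g A) ≡ ∑ f - ∑ g
    ∑-minus f g = trans (∑-cong (λ A → minus (f A) (g A)))
      (trans (∑-linear 1ℤ (- 1ℤ) f g) (sym (minus (∑ f) (∑ g))))

    g₁-level : Level (1ℤ + K) g₁
    g₁-level A = trans (cong (+ ∣ A ∣ *_) (g₁-linear A))
      (trans (linear-level (1ℤ + K) 1ℤ (- 1ℤ) (layer-level (1 ℕ.+ k)) (slice-level (1 ℕ.+ k) L) A)
        (cong ((1ℤ + K) *_) (sym (g₁-linear A))))

    ∑m : ∑ m ≡ (+ n - (1ℤ + K)) * G₁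
    ∑m = trans (∑-up-level (1ℤ + K) g₁-level) (cong ((+ n - (1ℤ + K)) *_) (∑-minus (layer (1 ℕ.+ k)) f₁))

    ∑E : ∑ E ≡ (+ n - (1ℤ + K)) * ((+ n - K) * a)
    ∑E = trans (∑-up-level (1ℤ + K) (up-level K (slice-level k L)))
      (cong ((+ n - (1ℤ + K)) *_) (∑-up-level K (slice-level k L)))

    Summed : ℤ → Set
    Summed ν = (K - 1ℤ) * (+ 2 * M * ((ν - (1ℤ + K)) * ((ν - K) * a)) - ∥ E ∥²)
      ≤ M * M * ((K - 1ℤ) * G₂ + (ν - (1ℤ + K)) * G₁)

    summed : Summed (+ 2 * K)
    summed = subst Summed n≡2K (begin
      (K - 1ℤ) * (+ 2 * M * ((+ n - (1ℤ + K)) * ((+ n - K) * a)) - ∥ E ∥²)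
        ≡⟨ cong (λ s → (K - 1ℤ) * (+ 2 * M * s - ∥ E ∥²)) ∑E ⟨
      (K - 1ℤ) * (+ 2 * M * ∑ E - ∥ E ∥²)
        ≡⟨ cong (λ s → (K - 1ℤ) * (s - ∥ E ∥²)) (∑-*ˡ (+ 2 * M) E) ⟨
      (K - 1ℤ) * (∑ (λ B → + 2 * M * E B) - ∥ E ∥²)
        ≡⟨ cong ((K - 1ℤ) *_) (∑-minus (λ B → + 2 * M * E B) (λ B → E B * E B)) ⟨
      (K - 1ℤ) * ∑ (λ B → + 2 * M * E B - E B * E B)
        ≡⟨ ∑-*ˡ (K - 1ℤ) (λ B → + 2 * M * E B - E B * E B) ⟨
      ∑ (λ B → (K - 1ℤ) * (+ 2 * M * E B - E B * E B))
        ≤⟨ ∑-mono local ⟩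
      ∑ (λ B → M * M * ((K - 1ℤ) * g₂ B + m B))
        ≡⟨ ∑-*ˡ (M * M) (λ B → (K - 1ℤ) * g₂ B + m B) ⟩
      M * M * ∑ (λ B → (K - 1ℤ) * g₂ B + m B)
        ≡⟨ cong (M * M *_) (∑-+ (λ B → (K - 1ℤ) * g₂ B) m) ⟩
      M * M * (∑ (λ B → (K - 1ℤ) * g₂ B) + ∑ m)
        ≡⟨ cong₂ (λ s t → M * M * (s + t))
             (trans (∑-*ˡ (K - 1ℤ) g₂) (cong ((K - 1ℤ) *_) (∑-minus (layer (2 ℕ.+ k)) f₂))) ∑m ⟩
      M * M * ((K - 1ℤ) * G₂ + (+ n - (1ℤ + K)) * G₁) ∎)
      where open ≤-Reasoning

    combine : ∀ K a G₁ G₂ X →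
      (K - 1ℤ) * (K * (1ℤ + K) * K * ((1ℤ + K) * (G₁ + G₂))) ≡
      (K - 1ℤ) * (K * (1ℤ + K) * K * ((K - 1ℤ) * a)) +
        (((K * (1ℤ + K)) * (K * (1ℤ + K)) * ((K - 1ℤ) * G₂ + (+ 2 * K - (1ℤ + K)) * G₁)
          - (K - 1ℤ) * (+ 2 * (K * (1ℤ + K)) * ((+ 2 * K - (1ℤ + K)) * ((+ 2 * K - K) * a)) - X))
        + (K - 1ℤ) * (K * K * (K * K - 1ℤ) * a - X))
    combine = solve-∀

  -- Splitting by size, binomial identities and the final count.

  card-slices : ∀ k (𝒜 : Collection n) →
    (∀ A → A ∈ᶜ 𝒜 → ∣ A ∣ ≡ k ⊎ ∣ A ∣ ≡ 1 ℕ.+ k ⊎ ∣ A ∣ ≡ 2 ℕ.+ k) →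
    + card 𝒜 ≡ ∑ (slice k (members 𝒜)) + ∑ (slice (1 ℕ.+ k) (members 𝒜)) + ∑ (slice (2 ℕ.+ k) (members 𝒜))
  card-slices {n} k 𝒜 sizes = begin
    + length L                                      ≡⟨ ∑-χ L ⟨
    ∑ (χ L)                                         ≡⟨ ∑-cong split ⟩
    ∑ (λ A → f₀ A + f₁ A + f₂ A)                    ≡⟨ ∑-+ (λ A → f₀ A + f₁ A) f₂ ⟩
    ∑ (λ A → f₀ A + f₁ A) + ∑ f₂                    ≡⟨ cong (_+ ∑ f₂) (∑-+ f₀ f₁) ⟩
    ∑ f₀ + ∑ f₁ + ∑ f₂                              ∎
    where
    open ≡-Reasoning
    L = members 𝒜
    f₀ = slice k L
    f₁ = slice (1 ℕ.+ k) L
    f₂ = slice (2 ℕ.+ k) L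
    off : ∀ i j A → ∣ A ∣ ≡ i → i ≢ j → slice j L A ≡ 0ℤ
    off i j A ∣A∣≡i i≢j = slice-off j L A (λ ∣A∣≡j → i≢j (trans (sym ∣A∣≡i) ∣A∣≡j))
    on : ∀ j A → ∣ A ∣ ≡ j → χ L A ≡ slice j L A
    on j A refl = sym (slice-on L A)
    unit₀ : ∀ x → x ≡ x + 0ℤ + 0ℤ
    unit₀ = solve-∀
    unit₁ : ∀ x → x ≡ 0ℤ + x + 0ℤ
    unit₁ = solve-∀
    unit₂ : ∀ x → x ≡ 0ℤ + 0ℤ + x
    unit₂ = solve-∀
    at : ∀ A {x y z} → f₀ A ≡ x → f₁ A ≡ y → f₂ A ≡ z → x + y + z ≡ f₀ A + f₁ A + f₂ A
    at A refl refl refl = refl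
    split : ∀ A → χ L A ≡ f₀ A + f₁ A + f₂ A
    split A with A ∈? L
    ... | no A∉L = trans (χ-∉ L A∉L) (at A (∉⇒0 k) (∉⇒0 (1 ℕ.+ k)) (∉⇒0 (2 ℕ.+ k)))
      where
      ∉⇒0 : ∀ j → slice j L A ≡ 0ℤ
      ∉⇒0 j = trans (cong (layer j A *_) (χ-∉ L A∉L)) (ℤ.*-zeroʳ (layer j A))
    ... | yes A∈L with sizes A A∈L
    ...   | inj₁ e = trans (unit₀ (χ L A))
            (at A (sym (on k A e)) (off k (1 ℕ.+ k) A e (ℕ.<⇒≢ (ℕ.m<n+m k (ℕ.s≤s (ℕ.z≤n {0})))))
                  (off k (2 ℕ.+ k) A e (ℕ.<⇒≢ (ℕ.m<n+m k (ℕ.s≤s (ℕ.z≤n {1}))))))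
    ...   | inj₂ (inj₁ e) = trans (unit₁ (χ L A))
            (at A (off (1 ℕ.+ k) k A e (ℕ.>⇒≢ (ℕ.m<n+m k (ℕ.s≤s (ℕ.z≤n {0})))))
                  (sym (on (1 ℕ.+ k) A e)) (off (1 ℕ.+ k) (2 ℕ.+ k) A e (ℕ.<⇒≢ (ℕ.n<1+n (1 ℕ.+ k)))))
    ...   | inj₂ (inj₂ e) = trans (unit₂ (χ L A))
            (at A (off (2 ℕ.+ k) k A e (ℕ.>⇒≢ (ℕ.m<n+m k (ℕ.s≤s (ℕ.z≤n {1})))))
                  (off (2 ℕ.+ k) (1 ℕ.+ k) A e (ℕ.>⇒≢ (ℕ.n<1+n (1 ℕ.+ k)))) (sym (on (2 ℕ.+ k) A e)))

  -- Both sides count the pairs of a j-set inside a (j+1)-set, by summing `up (layer j)` in two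
  -- ways.
  C-absorption : ∀ n j → + suc j * + (n C suc j) ≡ (+ n - + j) * + (n C j)
  C-absorption n j = begin
    + suc j * + (n C suc j)            ≡⟨ cong (+ suc j *_) (∑-layer n (suc j)) ⟨
    + suc j * ∑ {n} (layer (suc j))    ≡⟨ ∑-*ˡ {n} (+ suc j) (layer (suc j)) ⟨
    ∑ {n} (λ A → + suc j * layer (suc j) A) ≡⟨ ∑-cong {n} (up-layer j) ⟨
    ∑ {n} (up (layer j))               ≡⟨ ∑-up-level {n} (+ j) (layer-level j) ⟩
    (+ n - + j) * ∑ {n} (layer j)      ≡⟨ cong ((+ n - + j) *_) (∑-layer n j) ⟩
    (+ n - + j) * + (n C j)            ∎
    where open ≡-Reasoning

  -- Pascal's rule splits the central coefficient into two entries of the preceding odd row, equal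
  -- by symmetry. The halving in the final bound is therefore exact.
  central : ∀ k → (2 ℕ.* suc k) C suc k ≡ ((2 ℕ.* suc k ∸ 1) C suc k) ℕ.* 2
  central k = begin
    suc m C suc k            ≡⟨ nCk+nC[k+1]≡[n+1]C[k+1] m k ⟨
    m C k ℕ.+ m C suc k      ≡⟨ cong (ℕ._+ m C suc k) (nCk≡nC[n∸k] (ℕ.m≤m+n k (suc k ℕ.+ 0))) ⟩
    m C (m ∸ k) ℕ.+ m C suc k ≡⟨ cong (λ j → m C j ℕ.+ m C suc k) (trans (ℕ.m+n∸m≡n k (suc k ℕ.+ 0)) (ℕ.+-identityʳ (suc k))) ⟩
    m C suc k ℕ.+ m C suc k  ≡⟨ cong (m C suc k ℕ.+_) (ℕ.+-identityʳ (m C suc k)) ⟨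
    2 ℕ.* (m C suc k)        ≡⟨ ℕ.*-comm 2 (m C suc k) ⟩
    (m C suc k) ℕ.* 2        ∎
    where
    open ≡-Reasoning
    m = 2 ℕ.* suc k ∸ 1

  -- Pascal's rule writes the number of (k+2)-sets as d + c, and `absorption` trades (k + 1) d for
  -- (k - 1) h. After multiplication by k + 1 = (k - 1) + 2, the slack in the bound is the slack of
  -- `deficiency` plus that of `2a₀≤2h`.
  card-bound : ∀ (k : ℕ) → 2 ℕ.≤ k →
      (𝒜 : Collection (2 ℕ.* k)) →
      (∀ A → A ∈ᶜ 𝒜 → ∣ A ∣ ≡ k ⊎ ∣ A ∣ ≡ k ℕ.+ 1 ⊎ ∣ A ∣ ≡ k ℕ.+ 2) →
      Intersecting 𝒜 →
      Temperate 𝒜 →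
      card 𝒜 ℕ.≤ ((2 ℕ.* k) C k) / 2 ℕ.+ (2 ℕ.* k) C (k ℕ.+ 1) ℕ.+ (2 ℕ.* k ∸ 1) C (k ℕ.+ 2)
  card-bound k@(suc p) 2≤k 𝒜 sizes int temp =
    subst (card 𝒜 ℕ.≤_)
      (cong₂ ℕ._+_ (cong₂ ℕ._+_ (sym half) (cong (2k C_) (ℕ.+-comm 1 k))) (cong (q C_) (ℕ.+-comm 2 k)))
      (ℤ.drop‿+≤+ (subst (_≤ h + + N₁ + c) (sym cardinality)
        (*-cancelˡ {1ℤ + K} (+≤+ (ℕ.s≤s ℕ.z≤n)) (≤-by-difference
          (+-nonneg (ℤ.i≤j⇒0≤j-i deficiency) (ℤ.i≤j⇒0≤j-i 2a₀≤2h))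
          (combine K h (+ N₁) c d a₀ a₁ a₂ absorption)))))
    where
    2k = 2 ℕ.* k
    q = 2k ∸ 1
    K = + k
    N₁ = 2k C (1 ℕ.+ k)
    h = + (q C k)
    c = + (q C (2 ℕ.+ k))
    d = + (q C (1 ℕ.+ k))
    L = members 𝒜
    a₀ = ∑ (slice k L)
    a₁ = ∑ (slice (1 ℕ.+ k) L)
    a₂ = ∑ (slice (2 ℕ.+ k) L)

    2k≡k+k : 2k ≡ k ℕ.+ k
    2k≡k+k = cong (k ℕ.+_) (ℕ.+-identityʳ k)

    half : (2k C k) / 2 ≡ q C k
    half = trans (cong (_/ 2) (central p)) (m*n/n≡m (q C k) 2)

    sizes′ : ∀ A → A ∈ᶜ 𝒜 → ∣ A ∣ ≡ k ⊎ ∣ A ∣ ≡ 1 ℕ.+ k ⊎ ∣ A ∣ ≡ 2 ℕ.+ k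
    sizes′ A A∈𝒜 with sizes A A∈𝒜
    ... | inj₁ e        = inj₁ e
    ... | inj₂ (inj₁ e) = inj₂ (inj₁ (trans e (ℕ.+-comm k 1)))
    ... | inj₂ (inj₂ e) = inj₂ (inj₂ (trans e (ℕ.+-comm k 2)))

    cardinality : + card 𝒜 ≡ a₀ + a₁ + a₂
    cardinality = card-slices k 𝒜 sizes′

    2a₀≤2h : + 2 * a₀ ≤ + 2 * h
    2a₀≤2h = ℤ.≤-trans (middle-slice 2k≡k+k 𝒜 int) (ℤ.≤-reflexive (begin
      ∑ {2k} (layer k)   ≡⟨ ∑-layer 2k k ⟩
      + (2k C k)         ≡⟨ cong +_ (trans (central p) (ℕ.*-comm (q C k) 2)) ⟩
      + (2 ℕ.* (q C k)) ≡⟨ ℤ.pos-* 2 (q C k) ⟩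
      + 2 * h           ∎))
      where open ≡-Reasoning

    deficiency : (K - 1ℤ) * a₀ ≤ (1ℤ + K) * ((+ N₁ - a₁) + ((d + c) - a₂))
    deficiency = subst (λ s → (K - 1ℤ) * a₀ ≤ (1ℤ + K) * s)
      (cong₂ (λ s t → (s - a₁) + (t - a₂)) (∑-layer 2k (1 ℕ.+ k))
        (trans (∑-layer 2k (2 ℕ.+ k)) (cong +_ (sym (nCk+nC[k+1]≡[n+1]C[k+1] q (1 ℕ.+ k))))))
      (defect 2≤k 2k≡k+k 𝒜 int temp)

    absorption : (1ℤ + K) * d ≡ (K - 1ℤ) * h
    absorption = trans (C-absorption q k) (cong (_* h) q-k≡k-1)
      where
      shift : ∀ x → (x + (1ℤ + x)) - (1ℤ + x) ≡ (1ℤ + x) - 1ℤ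
      shift = solve-∀
      q-k≡k-1 : + q - K ≡ K - 1ℤ
      q-k≡k-1 = trans (cong (λ s → + (p ℕ.+ s) - K) (ℕ.+-identityʳ k)) (shift (+ p))

    combine : ∀ K h N c d a₀ a₁ a₂ → (1ℤ + K) * d ≡ (K - 1ℤ) * h →
      (1ℤ + K) * (h + N + c) ≡ (1ℤ + K) * (a₀ + a₁ + a₂) +
        (((1ℤ + K) * ((N - a₁) + ((d + c) - a₂)) - (K - 1ℤ) * a₀) + (+ 2 * h - + 2 * a₀))
    combine K h N c d a₀ a₁ a₂ eq = begin
      (1ℤ + K) * (h + N + c)
        ≡⟨ split K h N c ⟩
      (1ℤ + K) * (N + c) + (K - 1ℤ) * h + + 2 * h
        ≡⟨ cong (λ s → (1ℤ + K) * (N + c) + s + + 2 * h) eq ⟨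
      (1ℤ + K) * (N + c) + (1ℤ + K) * d + + 2 * h
        ≡⟨ regroup K h N c d a₀ a₁ a₂ ⟩
      (1ℤ + K) * (a₀ + a₁ + a₂) +
        (((1ℤ + K) * ((N - a₁) + ((d + c) - a₂)) - (K - 1ℤ) * a₀) + (+ 2 * h - + 2 * a₀)) ∎
      where
      open ≡-Reasoning
      split : ∀ K h N c → (1ℤ + K) * (h + N + c) ≡ (1ℤ + K) * (N + c) + (K - 1ℤ) * h + + 2 * h
      split = solve-∀
      regroup : ∀ K h N c d a₀ a₁ a₂ → (1ℤ + K) * (N + c) + (1ℤ + K) * d + + 2 * h ≡
        (1ℤ + K) * (a₀ + a₁ + a₂) +
          (((1ℤ + K) * ((N - a₁) + ((d + c) - a₂)) - (K - 1ℤ) * a₀) + (+ 2 * h - + 2 * a₀))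
      regroup = solve-∀

open import Data.Nat.Base using (_+_; _*_; _∸_; _≤_; _/_)

mainTheorem2 : ∀ (k : ℕ) → 2 ≤ k →
    (𝒜 : Collection (2 * k)) →
    (∀ A → A ∈ᶜ 𝒜 → ∣ A ∣ ≡ k ⊎ ∣ A ∣ ≡ k + 1 ⊎ ∣ A ∣ ≡ k + 2) →
    Intersecting 𝒜 →
    Temperate 𝒜 →
    card 𝒜 ≤ ((2 * k) C k) / 2 + (2 * k) C (k + 1) + (2 * k ∸ 1) C (k + 2)
mainTheorem2 = card-bound
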